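{- There is a constant $c>0$ such that for all integers $k\ge 2$, $\ell\ge 3$, $r\ge 2$ and $n\ge 2^{r+1}\ell+(k-2)\ell r$, the property $\mathcal{R}(P_\ell^{(k)},r,c,n)$ holds.
   Context: For integers $k\ge 2$, $\ell\ge 0$, the loose path $P_\ell^{(k)}$ is the $k$-uniform hypergraph ($k$-graph) with vertex set $\{v_1,\dots,v_{(k-1)\ell+1}\}$ and edges $e_i=\{v_{(i-1)(k-1)+q}:1\le q\le k\}$, $i=1,\dots,\ell$. $K_n^{(k)}$ is the complete $k$-graph on $n$ vertices. For a $k$-graph $F$, a constant $c>0$ and integers $r,n$, the property $\mathcal{R}(F,r,c,n)$ means: there is an algorithm which, for every coloring of the edges of $K_n^{(k)}$ with $r$ colors, finds a monochromatic copy of $F$ in time at most $c\,n^k$. -}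

module Defs where

open import Data.Bool as Bool using (_∧_)
open import Data.Fin using (Fin; zero; suc; toℕ; fromℕ<)
open import Data.Fin.Properties using (toℕ<n; toℕ-injective; fromℕ<-injective; suc-injective)
open import Data.Fin.Subset using (Subset; inside; outside; _∈_; _∉_; ∣_∣; ⁅_⁆; _∪_; ⊤; ⊥)
open import Data.Fin.Subset.Properties
  using (∣⊥∣≡0; ∣⊤∣≡n; ∉⊥; x∈⁅y⁆⇒x≡y; x∈p∪q⁻; ∪-identityˡ)
open import Data.Nat using (ℕ; zero; suc; _+_; _*_; _∸_; _^_; _≤_; _<_; _≡ᵇ_; s≤s⁻¹)
open import Data.Nat.Properties
  using (+-monoʳ-≤; +-comm; +-cancelˡ-≡; *-comm; *-monoˡ-≤; ≤-reflexive; module ≤-Reasoning)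
open import Data.Product using (Σ-syntax; ∃-syntax; _×_; _,_)
open import Data.Sum using (inj₁; inj₂)
open import Data.Vec using ([]; _∷_; here; there)
open import Function using (_∘_)
open import Function.Definitions using (Injective)
open import Level using (0ℓ)
open import Relation.Binary.PropositionalEquality
  using (_≡_; _≢_; refl; sym; trans; cong)
open import Relation.Nullary using (contradiction)
open import Relation.Unary using (Pred)

private
  variable
    k m n r : ℕ

image : (Fin m → Fin n) → Subset m → Subset n
image f []            = ⊥
image f (outside ∷ p) = image (f ∘ suc) p
image f (inside  ∷ p) = ⁅ f zero ⁆ ∪ image (f ∘ suc) p

∈-image⁻ : ∀ (f : Fin m → Fin n) p {x} → x ∈ image f p → ∃[ i ] i ∈ p × f i ≡ x
∈-image⁻ f [] x∈ = contradiction x∈ ∉⊥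
∈-image⁻ f (outside ∷ p) x∈ with ∈-image⁻ (f ∘ suc) p x∈
... | i , i∈p , fi≡x = suc i , there i∈p , fi≡x
∈-image⁻ f (inside ∷ p) x∈ with x∈p∪q⁻ ⁅ f zero ⁆ (image (f ∘ suc) p) x∈
... | inj₁ x∈⁅⁆ = zero , here , sym (x∈⁅y⁆⇒x≡y _ x∈⁅⁆)
... | inj₂ x∈im with ∈-image⁻ (f ∘ suc) p x∈im
...   | i , i∈p , fi≡x = suc i , there i∈p , fi≡x

∣⁅x⁆∪p∣ : ∀ (x : Fin n) p → x ∉ p → ∣ ⁅ x ⁆ ∪ p ∣ ≡ suc ∣ p ∣
∣⁅x⁆∪p∣ zero    (inside  ∷ p) x∉p = contradiction here x∉p
∣⁅x⁆∪p∣ zero    (outside ∷ p) x∉p = cong (suc ∘ ∣_∣) (∪-identityˡ p)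
∣⁅x⁆∪p∣ (suc x) (inside  ∷ p) x∉p = cong suc (∣⁅x⁆∪p∣ x p (x∉p ∘ there))
∣⁅x⁆∪p∣ (suc x) (outside ∷ p) x∉p = ∣⁅x⁆∪p∣ x p (x∉p ∘ there)

∣image∣ : ∀ {f : Fin m → Fin n} → Injective _≡_ _≡_ f → ∀ p → ∣ image f p ∣ ≡ ∣ p ∣
∣image∣ {n = n} inj [] = ∣⊥∣≡0 n
∣image∣ inj (outside ∷ p) = ∣image∣ (suc-injective ∘ inj) p
∣image∣ {f = f} inj (inside ∷ p) =
  trans (∣⁅x⁆∪p∣ (f zero) (image (f ∘ suc) p) f0∉) (cong suc (∣image∣ (suc-injective ∘ inj) p))
  where
  f0∉ : f zero ∉ image (f ∘ suc) p
  f0∉ f0∈ with ∈-image⁻ (f ∘ suc) p f0∈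
  ... | i , _ , fsi≡f0 with inj fsi≡f0
  ...   | ()

range : (Fin m → Fin n) → Subset n
range f = image f ⊤

∣range∣ : ∀ {f : Fin m → Fin n} → Injective _≡_ _≡_ f → ∣ range f ∣ ≡ m
∣range∣ inj = trans (∣image∣ inj ⊤) (∣⊤∣≡n _)

record Hypergraph (k : ℕ) : Set₁ where
  field
    order   : ℕ
    IsEdge  : Pred (Subset order) 0ℓ
    uniform : ∀ {e} → IsEdge e → ∣ e ∣ ≡ k

open Hypergraph public

complete : (k n : ℕ) → Hypergraph k
complete k n = record
  { order   = n
  ; IsEdge  = λ e → ∣ e ∣ ≡ k
  ; uniform = λ ∣e∣≡k → ∣e∣≡k
  }

pathVertex-< : ∀ k ℓ (i : Fin ℓ) (q : Fin k) → toℕ i * (k ∸ 1) + toℕ q < (k ∸ 1) * ℓ + 1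
pathVertex-< (suc k) ℓ i q = begin-strict
  toℕ i * k + toℕ q  ≤⟨ +-monoʳ-≤ (toℕ i * k) (s≤s⁻¹ (toℕ<n q)) ⟩
  toℕ i * k + k      ≡⟨ +-comm (toℕ i * k) k ⟩
  suc (toℕ i) * k    ≤⟨ *-monoˡ-≤ k (toℕ<n i) ⟩
  ℓ * k              ≡⟨ *-comm ℓ k ⟩
  k * ℓ              <⟨ ≤-reflexive (+-comm 1 (k * ℓ)) ⟩
  k * ℓ + 1          ∎
  where open ≤-Reasoning

-- The q-th vertex of the i-th edge; vertices, edges and q all count from 0.
pathVertex : ∀ k ℓ → Fin ℓ → Fin k → Fin ((k ∸ 1) * ℓ + 1)
pathVertex k ℓ i q = fromℕ< (pathVertex-< k ℓ i q)

pathVertex-injective : ∀ k ℓ i → Injective _≡_ _≡_ (pathVertex k ℓ i)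
pathVertex-injective k ℓ i {q} {q′} eq =
  toℕ-injective (+-cancelˡ-≡ (toℕ i * (k ∸ 1)) _ _
    (fromℕ<-injective _ _ (pathVertex-< k ℓ i q) (pathVertex-< k ℓ i q′) eq))

loosePath : (k ℓ : ℕ) → Hypergraph k
loosePath k ℓ = record
  { order   = (k ∸ 1) * ℓ + 1
  ; IsEdge  = λ e → ∃[ i ] e ≡ range (pathVertex k ℓ i)
  ; uniform = λ { (i , refl) → ∣range∣ (pathVertex-injective k ℓ i) }
  }

-- The irrelevant argument makes the colour depend on the edge only.
Coloring : Hypergraph k → ℕ → Set
Coloring G r = (e : Subset (order G)) → .(IsEdge G e) → Fin r

record IsMonochromaticCopy (F : Hypergraph k) (χ : Coloring (complete k n) r)
                           (f : Fin (order F) → Fin n) : Set where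
  field
    injective     : Injective _≡_ _≡_ f
    color         : Fin r
    monochromatic : ∀ e (e∈F : IsEdge F e) →
                    χ (image f e) (trans (∣image∣ injective e) (uniform F e∈F)) ≡ color

-- The model of computation is a random access machine with unit-cost addition
-- and truncated subtraction (and no multiplication), presented as while
-- programs over arrays of natural numbers. The coloring can be accessed only
-- through the instruction  b ≔color a , which reads k distinct vertices from
-- cells 0, …, k - 1 of array a and writes the color of the edge they form to
-- cell 0 of array b. A program that queries anything other than k distinct
-- vertices is stuck.

State : Set
State = ℕ → ℕ → ℕ

_[_,_↦_] : State → ℕ → ℕ → ℕ → State
(s [ a , i ↦ v ]) b j = Bool.if (a ≡ᵇ b) ∧ (i ≡ᵇ j) then v else s b j

infixl 6 _⊕_ _⊖_
data Expr : Set where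
  lit     : ℕ → Expr
  _at_    : (array : ℕ) → Expr → Expr
  _⊕_ _⊖_ : Expr → Expr → Expr

infixr 3 _⨟_
infix  4 _at_≔_ _≔color_
data Program : Set where
  skip          : Program
  _at_≔_        : (array : ℕ) → Expr → Expr → Program
  _≔color_      : (target source : ℕ) → Program
  _⨟_           : Program → Program → Program
  if_then_else_ : Expr → Program → Program → Program
  while_loop_   : Expr → Program → Program

eval : State → Expr → ℕ
eval s (lit v)  = v
eval s (a at x) = s a (eval s x)
eval s (x ⊕ y)  = eval s x + eval s y
eval s (x ⊖ y)  = eval s x ∸ eval s y

evalTime : Expr → ℕ
evalTime (lit v)  = 1
evalTime (a at x) = 1 + evalTime x
evalTime (x ⊕ y)  = 1 + evalTime x + evalTime y
evalTime (x ⊖ y)  = 1 + evalTime x + evalTime y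

-- Literals count with their magnitude, so that no table can be packed into one.
exprSize : Expr → ℕ
exprSize (lit v)  = 1 + v
exprSize (a at x) = 1 + exprSize x
exprSize (x ⊕ y)  = 1 + exprSize x + exprSize y
exprSize (x ⊖ y)  = 1 + exprSize x + exprSize y

size : Program → ℕ
size skip                    = 1
size (a at x ≔ y)            = 1 + exprSize x + exprSize y
size (b ≔color a)            = 1
size (p ⨟ q)                 = 1 + size p + size q
size (if x then p else q)    = 1 + exprSize x + size p + size q
size (while x loop p)        = 1 + exprSize x + size p

-- Run χ s p t s′ : on the coloring χ, program p started in state s halts in
-- state s′ after exactly t steps.  A test succeeds if its value is nonzero.
data Run {k n r} (χ : Coloring (complete k n) r) (s : State) : Program → ℕ → State → Set where
  skip    : Run χ s skip 1 s
  assign  : ∀ {a x y} →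
            Run χ s (a at x ≔ y) (1 + evalTime x + evalTime y) (s [ a , eval s x ↦ eval s y ])
  query   : ∀ {a b} (f : Fin k → Fin n) (inj : Injective _≡_ _≡_ f) →
            (∀ q → s a (toℕ q) ≡ toℕ (f q)) →
            Run χ s (b ≔color a) (1 + k) (s [ b , 0 ↦ toℕ (χ (range f) (∣range∣ inj)) ])
  seq     : ∀ {p q t u s′ s″} → Run χ s p t s′ → Run χ s′ q u s″ → Run χ s (p ⨟ q) (t + u) s″
  if-yes  : ∀ {x p q t s′} → eval s x ≢ 0 → Run χ s p t s′ →
            Run χ s (if x then p else q) (1 + evalTime x + t) s′
  if-no   : ∀ {x p q t s′} → eval s x ≡ 0 → Run χ s q t s′ →
            Run χ s (if x then p else q) (1 + evalTime x + t) s′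
  loop    : ∀ {x p t u s′ s″} → eval s x ≢ 0 → Run χ s p t s′ → Run χ s′ (while x loop p) u s″ →
            Run χ s (while x loop p) (1 + evalTime x + t + u) s″
  done    : ∀ {x p} → eval s x ≡ 0 → Run χ s (while x loop p) (1 + evalTime x) s

-- A copy of F is output by listing the images of its vertices in array 0.
OutputsMonochromaticCopy : (F : Hypergraph k) → Coloring (complete k n) r → State → Set
OutputsMonochromaticCopy {n = n} F χ s =
  Σ[ f ∈ (Fin (order F) → Fin n) ] IsMonochromaticCopy F χ f × (∀ v → s 0 (toℕ v) ≡ toℕ (f v))

-- The algorithm may depend on F, r and n; its input is the coloring, and its
-- memory is initially zero. The running time includes the time to read the
-- program itself: otherwise, for fixed n, a decision tree over all colorings
-- with a hard-coded answer at each leaf would run in time O(nᵏ) whatever the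
-- difficulty of the search.
ℛ : Hypergraph k → (r c n : ℕ) → Set
ℛ {k} F r c n =
  Σ[ p ∈ Program ] ∀ (χ : Coloring (complete k n) r) →
    ∃[ t ] ∃[ s ] Run χ (λ _ _ → 0) p t s × OutputsMonochromaticCopy F χ s × size p + t ≤ c * n ^ k

{-# OPTIONS --safe #-}
module Submission where

open import Defs
open import Data.Bool as Bool using (true; false)
open import Data.Empty using (⊥)
open import Data.Fin using (Fin; zero; suc; toℕ; fromℕ<)
open import Data.Fin.Properties using (toℕ<n; toℕ-injective; toℕ-fromℕ<)
open import Data.Fin.Subset using (Subset; inside; outside; _∈_; _⊆_; ∣_∣; ⊤)
open import Data.Fin.Subset.Properties using (x∈⁅x⁆; x∈p∪q⁺; ⊆-antisym; ∈⊤)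
open import Data.Nat
open import Data.Nat.DivMod
open import Data.Nat.Properties
open import Data.Nat.Tactic.RingSolver using (solve-∀)
open import Data.Product using (Σ-syntax; ∃-syntax; _×_; _,_; proj₁; proj₂)
open import Data.Sum using (_⊎_; inj₁; inj₂; [_,_]′)
open import Data.Unit using (tt) renaming (⊤ to 𝟏)
open import Data.Vec using (_∷_; here; there)
open import Function using (_∘_; id; const)
open import Function.Definitions using (Injective)
open import Level using (0ℓ)
open import Relation.Binary.PropositionalEquality
  using (_≡_; _≢_; refl; sym; trans; cong; cong₂; subst; module ≡-Reasoning)
open import Relation.Nullary
  using (Dec; yes; no; does; ¬_; ¬?; contradiction; contradiction-irr; _×-dec_)
open import Relation.Nullary.Decidable using (dec-true; dec-false; decidable-stable; toSum)
open import Relation.Unary using (Pred; Decidable)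

-- Let k = κ + 2 and ℓ = L + 1. Fix a spine of N = 2rℓ vertices and, outside
-- it, B disjoint blocks of κ vertices: B = r(ℓ ∸ 1) + 1 if κ > 0, and B = 1 if
-- κ = 0. A spine vertex v, a block b and a spine vertex u form an edge, and for
-- each color j in turn a depth-first search looks for a path on the spine whose
-- consecutive vertices are joined by edges of color j through distinct blocks.
-- The search backtracks when the last vertex v has no extension through a free
-- block, and then v is dead. Call v and u adjacent in color j if more blocks
-- give color j to them than can ever be in use. Then a vertex that dies has
-- fewer than ℓ living neighbors, all of them on the current path, so a failed
-- search leaves at most (ℓ ∸ 1)N adjacent pairs in color j. By the pigeonhole
-- principle every pair is adjacent in some color, so with N(N ∸ 1)/2 pairs some
-- search succeeds. All searches together try O(rN) vertices at the cost of
-- O(NBk) each, which is O(r³ℓ²Bk) = O(nᵏ) since r³ ≤ 4ʳ, 2ʳ⁺¹ℓ ≤ n and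
-- Bk ≤ 3nᵏ⁻².

-- Fixing the blocks in advance reduces the search to graphs on the spine: any block can stand
-- between any two spine vertices, so interior vertices are never chosen one by one, and extending a
-- path means looking at NB edges only. At most ℓ ∸ 1 blocks are in use, and r(ℓ ∸ 1) + 1 blocks
-- force some color onto ℓ of them. Counting needs N to exceed 2r(ℓ ∸ 1) + 1, which 2rℓ does.
--
-- The program has a single `while` loop. Each of its iterations tries all NB pairs afresh, by
-- straight-line code with the indices as literals. So the loop body is loop-free: weakest
-- preconditions settle its correctness, its time is read off its syntax, and termination rests on
-- one potential. The price is a long program whose literals, of size up to n, are charged by
-- magnitude. It still has size at most 300nᵏ, and the constant 1991 is this 300 plus 1691 for the
-- running time.

private
  variable
    P Q   : Set
    k n r : ℕ

-- Sums and counting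

∑ : ℕ → (ℕ → ℕ) → ℕ
∑ zero    f = 0
∑ (suc n) f = ∑ n f + f n

∑-mono : ∀ n {f g : ℕ → ℕ} → (∀ {i} → i < n → f i ≤ g i) → ∑ n f ≤ ∑ n g
∑-mono zero    f≤g = z≤n
∑-mono (suc n) f≤g = +-mono-≤ (∑-mono n (λ i<n → f≤g (m<n⇒m<1+n i<n))) (f≤g ≤-refl)

∑-cong : ∀ n {f g : ℕ → ℕ} → (∀ i → f i ≡ g i) → ∑ n f ≡ ∑ n g
∑-cong zero    f≡g = refl
∑-cong (suc n) f≡g = cong₂ _+_ (∑-cong n f≡g) (f≡g n)

∑-+ : ∀ n (f g : ℕ → ℕ) → ∑ n (λ i → f i + g i) ≡ ∑ n f + ∑ n g
∑-+ zero    f g = refl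
∑-+ (suc n) f g = begin
  ∑ n (λ i → f i + g i) + (f n + g n)  ≡⟨ cong (_+ (f n + g n)) (∑-+ n f g) ⟩
  ∑ n f + ∑ n g + (f n + g n)          ≡⟨ interchange (∑ n f) (∑ n g) (f n) (g n) ⟩
  ∑ n f + f n + (∑ n g + g n)          ∎
  where
  open ≡-Reasoning
  interchange : ∀ a b c d → a + b + (c + d) ≡ a + c + (b + d)
  interchange = solve-∀

∑-const : ∀ n c → ∑ n (const c) ≡ n * c
∑-const zero    c = refl
∑-const (suc n) c = trans (cong (_+ c) (∑-const n c)) (+-comm (n * c) c)

∑-≤-const : ∀ n {f : ℕ → ℕ} {c} → (∀ {i} → i < n → f i ≤ c) → ∑ n f ≤ n * c
∑-≤-const n {c = c} f≤c = ≤-trans (∑-mono n f≤c) (≤-reflexive (∑-const n c))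

∑-swap : ∀ m n (f : ℕ → ℕ → ℕ) → ∑ m (λ i → ∑ n (f i)) ≡ ∑ n (λ j → ∑ m (λ i → f i j))
∑-swap zero    n f = sym (trans (∑-const n 0) (*-zeroʳ n))
∑-swap (suc m) n f = begin
  ∑ m (λ i → ∑ n (f i)) + ∑ n (f m)        ≡⟨ cong (_+ ∑ n (f m)) (∑-swap m n f) ⟩
  ∑ n (λ j → ∑ m (λ i → f i j)) + ∑ n (f m)  ≡⟨ ∑-+ n _ (f m) ⟨
  ∑ n (λ j → ∑ m (λ i → f i j) + f m j)      ∎
  where open ≡-Reasoning

term≤∑ : ∀ n (f : ℕ → ℕ) {i} → i < n → f i ≤ ∑ n f
term≤∑ (suc n) f i<1+n with m<1+n⇒m<n∨m≡n i<1+n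
... | inj₁ i<n  = ≤-trans (term≤∑ n f i<n) (m≤m+n _ _)
... | inj₂ refl = m≤n+m _ _

∑-mono-< : ∀ n {f g : ℕ → ℕ} → (∀ {i} → i < n → f i ≤ g i) → ∀ {i} → i < n → f i < g i → ∑ n f < ∑ n g
∑-mono-< (suc n) f≤g i<1+n fi<gi with m<1+n⇒m<n∨m≡n i<1+n
... | inj₁ i<n  = +-mono-<-≤ (∑-mono-< n (λ j<n → f≤g (m<n⇒m<1+n j<n)) i<n fi<gi) (f≤g ≤-refl)
... | inj₂ refl = +-mono-≤-< (∑-mono n (λ j<n → f≤g (m<n⇒m<1+n j<n))) fi<gi

𝟙 : Dec P → ℕ
𝟙 p = Bool.if does p then 1 else 0

𝟙-mono : (p : Dec P) (q : Dec Q) → (P → Q) → 𝟙 p ≤ 𝟙 q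
𝟙-mono (no _)  q       P→Q = z≤n
𝟙-mono (yes p) (yes q) P→Q = ≤-refl
𝟙-mono (yes p) (no ¬q) P→Q = contradiction (P→Q p) ¬q

𝟙-cover : (p : Dec P) (q : Dec Q) {n : ℕ} → (P → Q ⊎ 1 ≤ n) → 𝟙 p ≤ 𝟙 q + n
𝟙-cover (no _)  q       c = z≤n
𝟙-cover (yes p) (yes q) c = s≤s z≤n
𝟙-cover (yes p) (no ¬q) c with c p
... | inj₁ q   = contradiction q ¬q
... | inj₂ 1≤n = 1≤n

𝟙-yes : (p : Dec P) → P → 1 ≤ 𝟙 p
𝟙-yes (yes _) p = ≤-refl
𝟙-yes (no ¬p) p = contradiction p ¬p

𝟙-no : (p : Dec P) → ¬ P → 𝟙 p ≡ 0
𝟙-no (yes p) ¬p = contradiction p ¬p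
𝟙-no (no _)  ¬p = refl

𝟙≤1 : (p : Dec P) → 𝟙 p ≤ 1
𝟙≤1 (yes _) = ≤-refl
𝟙≤1 (no _)  = z≤n

count : ℕ → {P : Pred ℕ 0ℓ} → Decidable P → ℕ
count n P? = ∑ n (λ i → 𝟙 (P? i))

count≤ : ∀ n {P : Pred ℕ 0ℓ} (P? : Decidable P) → count n P? ≤ n
count≤ n P? = ≤-trans (∑-≤-const n (λ {i} _ → 𝟙≤1 (P? i))) (≤-reflexive (*-identityʳ n))

-- Collapses a sum over pairs with one coordinate pinned to `w` into a single sum; this is how the
-- degree of a vertex emerges in `edgesOn-delete`.
count-point : ∀ n w (q : Dec Q) → count n (λ v → v ≟ w ×-dec q) ≤ 𝟙 q
count-point zero    w q = z≤n
count-point (suc n) w q with n ≟ w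
... | no n≢w = begin
  count n (λ v → v ≟ w ×-dec q) + 𝟙 (n ≟ w ×-dec q)
    ≡⟨ cong (count n (λ v → v ≟ w ×-dec q) +_) (𝟙-no (n ≟ w ×-dec q) (n≢w ∘ proj₁)) ⟩
  count n (λ v → v ≟ w ×-dec q) + 0
    ≡⟨ +-identityʳ _ ⟩
  count n (λ v → v ≟ w ×-dec q)
    ≤⟨ count-point n w q ⟩
  𝟙 q ∎
  where open ≤-Reasoning
... | yes refl = begin
  count n (λ v → v ≟ n ×-dec q) + 𝟙 (n ≟ n ×-dec q)
    ≤⟨ +-mono-≤ (∑-≤-const n (λ {v} v<n → ≤-reflexive (𝟙-no (v ≟ n ×-dec q) (<⇒≢ v<n ∘ proj₁))))
                (𝟙-mono (n ≟ n ×-dec q) q proj₂) ⟩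
  n * 0 + 𝟙 q  ≡⟨ cong (_+ 𝟙 q) (*-zeroʳ n) ⟩
  𝟙 q          ∎
  where open ≤-Reasoning

count-singleton : ∀ n w → count n (_≟ w) ≤ 1
count-singleton n w = ≤-trans
  (∑-mono n (λ {v} _ → 𝟙-mono (v ≟ w) (v ≟ w ×-dec w ≟ w) (_, refl)))
  (≤-trans (count-point n w (w ≟ w)) (𝟙≤1 (w ≟ w)))

-- Double counting of the pairs with `i ≡ g d`: each `i` in `P` lies in at least one, each `d` in at
-- most one. It bounds hits by blocks in use and living neighbors by path vertices.
count-cover : ∀ n K (g : ℕ → ℕ) {P : Pred ℕ 0ℓ} (P? : Decidable P) →
              (∀ {i} → i < n → P i → ∃[ d ] d < K × g d ≡ i) → count n P? ≤ K
count-cover n K g P? cover = begin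
  count n P?                         ≤⟨ ∑-mono n (λ {i} i<n → pointwise i<n (P? i)) ⟩
  ∑ n (λ i → ∑ K (λ d → 𝟙 (i ≟ g d)))  ≡⟨ ∑-swap n K (λ i d → 𝟙 (i ≟ g d)) ⟩
  ∑ K (λ d → count n (_≟ g d))       ≤⟨ ∑-≤-const K (λ {d} _ → count-singleton n (g d)) ⟩
  K * 1                              ≡⟨ *-identityʳ K ⟩
  K                                  ∎
  where
  open ≤-Reasoning
  pointwise : ∀ {i} → i < n → (p : Dec _) → 𝟙 p ≤ ∑ K (λ d → 𝟙 (i ≟ g d))
  pointwise i<n (no _)  = z≤n
  pointwise {i} i<n (yes p) with cover i<n p
  ... | d , d<K , refl =
    ≤-trans (𝟙-yes (i ≟ i) refl) (term≤∑ K (λ e → 𝟙 (i ≟ g e)) d<K)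

-- The Boolean test is the one in state updates, so `config` of an updated state computes to an
-- `upd` of the old field.
upd : (ℕ → ℕ) → ℕ → ℕ → ℕ → ℕ
upd f i v j = Bool.if i ≡ᵇ j then v else f j

upd-≡ : ∀ f i v → upd f i v i ≡ v
upd-≡ f i v with i ≡ᵇ i | ≡⇒≡ᵇ i i refl
... | true | _ = refl

upd-≢ : ∀ f {i} v {j} → i ≢ j → upd f i v j ≡ f j
upd-≢ f {i} v {j} i≢j with i ≡ᵇ j | ≡ᵇ⇒≡ i j
... | true  | eq = contradiction (eq _) i≢j
... | false | _  = refl

-- Depth-first search

snoc : ∀ {n} f v (A : ℕ → ℕ → Set) → A n v → (∀ {d} → d < n → A d (f d)) →
       ∀ {d} → d < suc n → A d (upd f n v d)
snoc {n} f v A new old d<1+n with m<1+n⇒m<n∨m≡n d<1+n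
... | inj₁ d<n  = subst (A _) (sym (upd-≢ f v (>⇒≢ d<n))) (old d<n)
... | inj₂ refl = subst (A n) (sym (upd-≡ f n v)) new

-- A block in use is marked by D ∸ M, where D is its depth. For k > 2, M = 0. For
-- k = 2 blocks are empty and may be shared, and M = ℓ leaves them all unmarked.
Extreme : ℕ → ℕ → Set
Extreme L M = M ≡ 0 ⊎ suc L ≤ M

-- Equal marks at different depths exclude `M ≡ 0`, and otherwise every mark is 0. Hence erasing the
-- mark of a popped block that also occurs lower on the path changes nothing.
extreme-repeat : ∀ {L M d e} → Extreme L M → d < e → e ≤ suc L → d ∸ M ≡ e ∸ M → e ∸ M ≡ 0
extreme-repeat (inj₁ refl)  d<e e≤1+L eq = contradiction eq (<⇒≢ d<e)
extreme-repeat (inj₂ 1+L≤M) d<e e≤1+L eq = m≤n⇒m∸n≡0 (≤-trans e≤1+L 1+L≤M)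

-- A zero mark at positive depth excludes `M ≡ 0`, so all marks up to depth ℓ vanish. This handles a
-- push that reuses a block of the path.
extreme-zero : ∀ {L M d e} → Extreme L M → suc d ∸ M ≡ 0 → e ≤ suc L → e ∸ M ≡ 0
extreme-zero (inj₁ refl)  ()
extreme-zero (inj₂ 1+L≤M) eq e≤1+L = m≤n⇒m∸n≡0 (≤-trans e≤1+L 1+L≤M)

∸≢0 : ∀ {m n} → m ∸ n ≢ 0 → ∃[ d ] n ≤ d × suc d ≡ m
∸≢0 {zero}  {n}     m∸n≢0 = contradiction (0∸n≡0 n) m∸n≢0
∸≢0 {suc m} {n}     m∸n≢0 = m , s≤s⁻¹ (≰⇒> (m∸n≢0 ∘ m≤n⇒m∸n≡0)) , refl

-- The path has vertices 0, …, depth ∸ 1, and block (suc d) joins vertices d and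
-- suc d; block 0 is meaningless. The value suc color in visited and dead says
-- yes and smaller values say no, so that a new color resets both.
record Config : Set where
  constructor mkConfig
  field
    depth color                      : ℕ
    vertex block visited dead marked : ℕ → ℕ

open Config

push : ℕ → ℕ → ℕ → Config → Config
push M u b (mkConfig D C S X vis ded mrk) =
  mkConfig (suc D) C (upd S D u) (upd X D b) (upd vis u (suc C)) ded (upd mrk b (D ∸ M))

pop : Config → Config
pop (mkConfig D C S X vis ded mrk) =
  mkConfig (D ∸ 1) C S X vis (upd ded (S (D ∸ 1)) (suc C)) (upd mrk (X (D ∸ 1)) 0)

nextColor : Config → Config
nextColor (mkConfig D C S X vis ded mrk) = mkConfig D (suc C) S X vis ded mrk

-- Invariant and potential of the search

module Search (N B r L M : ℕ) (col : ℕ → ℕ → ℕ → ℕ) where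

  -- Every vertex can start a path.
  branchColor : Config → ℕ → ℕ → ℕ
  branchColor (mkConfig zero    C _ _ _ _ _) u b = C
  branchColor (mkConfig (suc d) C S _ _ _ _) u b = col (S d) b u

  record Accepts (c : Config) (u b : ℕ) : Set where
    constructor accepts
    field
      unmarked  : marked c b ≡ 0
      unvisited : visited c u ≤ color c
      fits      : branchColor c u b ≡ color c

  Rejects : Config → ℕ → ℕ → Set
  Rejects c u b = ¬ Accepts c u b

  hits? : ∀ j v u → Decidable (λ b → col v b u ≡ j)
  hits? j v u b = col v b u ≟ j

  -- No more than L ∸ M blocks are marked at a time, so a free one remains.
  Adj : ℕ → ℕ → ℕ → Set
  Adj j v u = v ≢ u × L ∸ M < count B (hits? j v u)

  adj? : ∀ j v u → Dec (Adj j v u)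
  adj? j v u = ¬? (v ≟ u) ×-dec (L ∸ M <? count B (hits? j v u))

  edges : ℕ → ℕ
  edges j = ∑ N λ v → count N (adj? j v)

  edgesOn : ℕ → {A : Pred ℕ 0ℓ} → Decidable A → ℕ
  edgesOn j A? = ∑ N λ v → count N (λ u → A? v ×-dec A? u ×-dec adj? j v u)

  Alive : Config → Pred ℕ 0ℓ
  Alive c u = dead c u ≤ color c

  alive? : ∀ c → Decidable (Alive c)
  alive? c u = dead c u ≤? color c

  -- `budget` is the edge count in incremental form: it holds trivially while everything is alive,
  -- and once nothing is alive `edgesOn` vanishes and it becomes an entry of `exhausted`.
  -- `alive-visited` is what places the living visited neighbors of a dying vertex on the path.
  record Inv (c : Config) : Set where
    field
      depth≤          : depth c ≤ 2 + L
      color<          : color c < r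
      vertex<         : ∀ {d} → d < depth c → vertex c d < N
      vertex-visited  : ∀ {d} → d < depth c → visited c (vertex c d) ≡ suc (color c)
      vertex-alive    : ∀ {d} → d < depth c → Alive c (vertex c d)
      vertex-inj      : ∀ {d e} → d < depth c → e < depth c → vertex c d ≡ vertex c e → d ≡ e
      block<          : ∀ {d} → d < depth c → block c d < B
      block-marked    : ∀ {d} → suc d < depth c → marked c (block c (suc d)) ≡ suc d ∸ M
      marked-block    : ∀ {b} → marked c b ≢ 0 →
                        ∃[ d ] M ≤ d × suc d < depth c × block c (suc d) ≡ b
      monochromatic   : ∀ {d} → suc d < depth c →
                        col (vertex c d) (block c (suc d)) (vertex c (suc d)) ≡ color c
      visited≤        : ∀ u → visited c u ≤ suc (color c)
      dead≤           : ∀ u → dead c u ≤ suc (color c)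
      unvisited-alive : ∀ {u} → visited c u ≤ color c → Alive c u
      alive-visited   : ∀ {u} → Alive c u → visited c u ≡ suc (color c) →
                        ∃[ d ] d < depth c × vertex c d ≡ u
      -- A death costs up to L adjacent pairs, each counted in both orders.
      budget          : edges (color c) + 2 * L * count N (alive? c) ≤
                        edgesOn (color c) (alive? c) + 2 * L * N
      exhausted       : ∀ {j} → j < color c → edges j ≤ 2 * L * N

  unvisited? : ∀ c → Decidable (λ u → visited c u ≤ color c)
  unvisited? c u = visited c u ≤? color c

  -- A push loses 2 for the vertex it visits and regains 1 in depth; a pop loses 1. A change of
  -- color makes at most N vertices unvisited again, worth 2N, and is paid for by the weight 2N + 1
  -- of a color.
  potential : Config → ℕ
  potential c = (r ∸ color c) * suc (2 * N) + (2 * count N (unvisited? c) + depth c)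

  -- The new vertex is unvisited, hence off the path and alive. Since `dead` and the color do not
  -- change, `budget` and `exhausted` carry over; the delicate field is `block-marked`.
  push-inv : ∀ {c u b} → Extreme L M → Inv c → depth c < 2 + L → u < N → b < B → Accepts c u b →
             Inv (push M u b c)
  push-inv {c@(mkConfig D C S X vis ded mrk)} {u} {b} M-extreme I (s≤s D≤1+L) u<N b<B (accepts mb≡0 vis≤ fits) = record
    { depth≤          = s≤s D≤1+L
    ; color<          = color<
    ; vertex<         = snoc S u (λ _ v → v < N) u<N vertex<
    ; vertex-visited  = snoc S u (λ _ v → vis′ v ≡ suc C) (upd-≡ vis u (suc C))
                          (λ d<D → trans (upd-≢ vis (suc C) (u≢S d<D)) (vertex-visited d<D))
    ; vertex-alive    = snoc S u (λ _ v → ded v ≤ C) (unvisited-alive vis≤) vertex-alive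
    ; vertex-inj      = λ {d} {e} d< e< → inj d< e<
    ; block<          = snoc X b (λ _ x → x < B) b<B block<
    ; block-marked    = λ {d} → bm {d}
    ; marked-block    = mb
    ; monochromatic   = λ {d} → mono {d}
    ; visited≤        = vis≤′
    ; dead≤           = dead≤
    ; unvisited-alive = λ {x} → unv {x}
    ; alive-visited   = λ {x} → av {x}
    ; budget          = budget
    ; exhausted       = exhausted
    }
    where
    open Inv I
    S′ X′ vis′ mrk′ : ℕ → ℕ
    S′ = upd S D u
    X′ = upd X D b
    vis′ = upd vis u (suc C)
    mrk′ = upd mrk b (D ∸ M)
    u≢S : ∀ {d} → d < D → u ≢ S d
    u≢S d<D refl = <⇒≱ ≤-refl (≤-trans (≤-reflexive (sym (vertex-visited d<D))) vis≤)
    S-old : ∀ {d} → d < D → S′ d ≡ S d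
    S-old d<D = upd-≢ S u (>⇒≢ d<D)
    X-old : ∀ {d} → d < D → X′ d ≡ X d
    X-old d<D = upd-≢ X b (>⇒≢ d<D)
    inj : ∀ {d e} → d < suc D → e < suc D → S′ d ≡ S′ e → d ≡ e
    inj d< e< eq with m<1+n⇒m<n∨m≡n d< | m<1+n⇒m<n∨m≡n e<
    ... | inj₁ d<D  | inj₁ e<D  = vertex-inj d<D e<D (trans (sym (S-old d<D)) (trans eq (S-old e<D)))
    ... | inj₁ d<D  | inj₂ refl = contradiction (trans (sym (upd-≡ S D u)) (trans (sym eq) (S-old d<D))) (u≢S d<D)
    ... | inj₂ refl | inj₁ e<D  = contradiction (trans (sym (upd-≡ S D u)) (trans eq (S-old e<D))) (u≢S e<D)
    ... | inj₂ refl | inj₂ refl = refl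
    bm : ∀ {d} → suc d < suc D → mrk′ (X′ (suc d)) ≡ suc d ∸ M
    bm {d} 1+d< with m<1+n⇒m<n∨m≡n 1+d<
    ... | inj₂ refl rewrite upd-≡ X D b = upd-≡ mrk b (D ∸ M)
    ... | inj₁ 1+d<D rewrite X-old 1+d<D with b ≟ X (suc d)
    ...   | no b≢ = trans (upd-≢ mrk (D ∸ M) b≢) (block-marked 1+d<D)
    -- The chosen block already lies on the path and yet is unmarked, which can happen only if all
    -- marks are 0.
    ...   | yes refl = begin
      mrk′ b     ≡⟨ upd-≡ mrk b (D ∸ M) ⟩
      D ∸ M      ≡⟨ extreme-zero M-extreme (trans (sym (block-marked 1+d<D)) mb≡0) D≤1+L ⟩
      0          ≡⟨ mb≡0 ⟨
      mrk b      ≡⟨ block-marked 1+d<D ⟩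
      suc d ∸ M  ∎
      where
      open ≡-Reasoning
    mb : ∀ {x} → mrk′ x ≢ 0 → ∃[ d ] M ≤ d × suc d < suc D × X′ (suc d) ≡ x
    mb {x} m≢0 with b ≟ x
    ... | no b≢x with marked-block (m≢0 ∘ trans (upd-≢ mrk (D ∸ M) b≢x))
    ...   | d , M≤d , 1+d<D , eq = d , M≤d , m<n⇒m<1+n 1+d<D , trans (X-old 1+d<D) eq
    mb {x} m≢0 | yes refl with ∸≢0 (m≢0 ∘ trans (upd-≡ mrk b (D ∸ M)))
    ... | d , M≤d , 1+d≡D = d , M≤d , s≤s (≤-reflexive 1+d≡D) , trans (cong X′ 1+d≡D) (upd-≡ X D b)
    mono : ∀ {d} → suc d < suc D → col (S′ d) (X′ (suc d)) (S′ (suc d)) ≡ C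
    mono {d} 1+d< with m<1+n⇒m<n∨m≡n 1+d<
    ... | inj₁ 1+d<D rewrite X-old 1+d<D | S-old 1+d<D | S-old (<-trans (n<1+n d) 1+d<D) = monochromatic 1+d<D
    ... | inj₂ refl rewrite upd-≡ X D b | upd-≡ S D u | S-old (n<1+n d) = fits
    vis≤′ : ∀ x → vis′ x ≤ suc C
    vis≤′ x with u ≟ x
    ... | yes refl = ≤-reflexive (upd-≡ vis u (suc C))
    ... | no u≢x   = ≤-trans (≤-reflexive (upd-≢ vis (suc C) u≢x)) (visited≤ x)
    unv : ∀ {x} → vis′ x ≤ C → ded x ≤ C
    unv {x} v≤ with u ≟ x
    ... | yes refl = unvisited-alive vis≤
    ... | no u≢x   = unvisited-alive (≤-trans (≤-reflexive (sym (upd-≢ vis (suc C) u≢x))) v≤)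
    av : ∀ {x} → ded x ≤ C → vis′ x ≡ suc C → ∃[ d ] d < suc D × S′ d ≡ x
    av {x} al v≡ with u ≟ x
    ... | yes refl = D , ≤-refl , upd-≡ S D u
    ... | no u≢x with alive-visited al (trans (sym (upd-≢ vis (suc C) u≢x)) v≡)
    ...   | d , d<D , eq = d , m<n⇒m<1+n d<D , trans (S-old d<D) eq

  push-potential : ∀ {c u b} → u < N → Accepts c u b → potential (push M u b c) < potential c
  push-potential {c@(mkConfig D C S X vis ded mrk)} {u} {b} u<N (accepts _ vis≤ _) =
    +-monoʳ-< ((r ∸ C) * suc (2 * N)) (begin-strict
      2 * U′ + suc D     <⟨ n<1+n _ ⟩
      suc (2 * U′ + suc D) ≡⟨ shift U′ D ⟩
      2 * suc U′ + D     ≤⟨ +-monoˡ-≤ D (*-monoʳ-≤ 2 U′<U) ⟩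
      2 * U + D          ∎)
    where
    open ≤-Reasoning
    U U′ : ℕ
    U  = count N (unvisited? c)
    U′ = count N (unvisited? (push M u b c))
    shift : ∀ a d → suc (2 * a + suc d) ≡ 2 * suc a + d
    shift = solve-∀
    new≰ : ¬ (upd vis u (suc C) u ≤ C)
    new≰ le = <⇒≱ ≤-refl (≤-trans (≤-reflexive (sym (upd-≡ vis u (suc C)))) le)
    still : ∀ {x} → upd vis u (suc C) x ≤ C → vis x ≤ C
    still {x} le with u ≟ x
    ... | yes refl = contradiction le new≰
    ... | no u≢x   = ≤-trans (≤-reflexive (sym (upd-≢ vis (suc C) u≢x))) le
    U′<U : U′ < U
    U′<U = ∑-mono-< N (λ {x} _ → 𝟙-mono (upd vis u (suc C) x ≤? C) (vis x ≤? C) still) u<N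
      (≤-trans (s≤s (≤-reflexive (𝟙-no (upd vis u (suc C) u ≤? C) new≰))) (𝟙-yes (vis u ≤? C) vis≤))

  pop-potential : ∀ {c} → depth c ≢ 0 → potential (pop c) < potential c
  pop-potential {mkConfig zero    _ _ _ _ _ _} d≢0 = contradiction refl d≢0
  pop-potential {c@(mkConfig (suc d) C _ _ _ _ _)} _ =
    +-monoʳ-< ((r ∸ C) * suc (2 * N)) (+-monoʳ-< (2 * count N (unvisited? c)) ≤-refl)

  nextColor-potential : ∀ {c} → depth c ≡ 0 → Inv c → potential (nextColor c) < potential c
  nextColor-potential {c@(mkConfig zero C S X vis ded mrk)} refl I = begin-strict
    (r ∸ suc C) * suc (2 * N) + (2 * count N (unvisited? (nextColor c)) + 0)
      ≤⟨ +-monoʳ-≤ ((r ∸ suc C) * suc (2 * N)) (+-monoˡ-≤ 0 (*-monoʳ-≤ 2 (count≤ N (unvisited? (nextColor c))))) ⟩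
    (r ∸ suc C) * suc (2 * N) + (2 * N + 0)
      <⟨ ≤-reflexive (shift (r ∸ suc C) (2 * N)) ⟩
    suc (r ∸ suc C) * suc (2 * N)
      ≡⟨ cong (_* suc (2 * N)) (+-∸-assoc 1 (Inv.color< I)) ⟨
    (r ∸ C) * suc (2 * N)
      ≤⟨ m≤m+n _ _ ⟩
    (r ∸ C) * suc (2 * N) + (2 * count N (unvisited? c) + 0) ∎
    where
    open ≤-Reasoning
    shift : ∀ a b → suc (a * suc b + (b + 0)) ≡ suc a * suc b
    shift = solve-∀

  module _ (col-sym : ∀ v b u → col v b u ≡ col u b v) where

    adj-sym : ∀ {j v u} → Adj j v u → Adj j u v
    adj-sym {j} {v} {u} (v≢u , hits) = v≢u ∘ sym , ≤-trans hits (∑-mono B λ {b} _ →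
      𝟙-mono (hits? j v u b) (hits? j u v b) (trans (col-sym u b v)))

    -- A lost pair has `w` at one of its ends and is charged to `new v u` or `new u v` accordingly,
    -- `adj-sym` moving `w` to the front in the second case. Either total is at most the degree of
    -- `w`, whence the factor 2.
    edgesOn-delete : ∀ j w {A A′ : Pred ℕ 0ℓ} (A? : Decidable A) (A′? : Decidable A′) {K} →
                     (∀ {v} → A v → v ≡ w ⊎ A′ v) → count N (λ u → A? u ×-dec adj? j w u) ≤ K →
                     edgesOn j A? ≤ edgesOn j A′? + 2 * K
    edgesOn-delete j w {A} {A′} A? A′? {K} A⇒ deg≤K = begin
      edgesOn j A?
        ≤⟨ ∑-mono N (λ {v} _ → ∑-mono N (λ {u} _ → pointwise v u)) ⟩
      (∑ N λ v → ∑ N λ u → old v u + (new v u + new u v))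
        ≡⟨ ∑-cong N (λ v → ∑-+ N (old v) (λ u → new v u + new u v)) ⟩
      (∑ N λ v → ∑ N (old v) + ∑ N (λ u → new v u + new u v))
        ≡⟨ ∑-+ N _ _ ⟩
      edgesOn j A′? + (∑ N λ v → ∑ N λ u → new v u + new u v)
        ≡⟨ cong (edgesOn j A′? +_) (∑-cong N (λ v → ∑-+ N (new v) (λ u → new u v))) ⟩
      edgesOn j A′? + (∑ N λ v → ∑ N (new v) + ∑ N (λ u → new u v))
        ≡⟨ cong (edgesOn j A′? +_) (∑-+ N _ _) ⟩
      edgesOn j A′? + ((∑ N λ v → ∑ N (new v)) + (∑ N λ v → ∑ N λ u → new u v))
        ≤⟨ +-monoʳ-≤ (edgesOn j A′?) (+-mono-≤ (≤-trans (≤-reflexive (∑-swap N N new)) news)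
                                                 (≤-trans news (≤-reflexive (sym (+-identityʳ K))))) ⟩
      edgesOn j A′? + 2 * K ∎
      where
      open ≤-Reasoning
      old new : ℕ → ℕ → ℕ
      old v u = 𝟙 (A′? v ×-dec A′? u ×-dec adj? j v u)
      new v u = 𝟙 (v ≟ w ×-dec A? u ×-dec adj? j w u)
      pointwise : ∀ v u → 𝟙 (A? v ×-dec A? u ×-dec adj? j v u) ≤ old v u + (new v u + new u v)
      pointwise v u = 𝟙-cover (A? v ×-dec A? u ×-dec adj? j v u) (A′? v ×-dec A′? u ×-dec adj? j v u) cases
        where
        cases : A v × A u × Adj j v u → (A′ v × A′ u × Adj j v u) ⊎ 1 ≤ new v u + new u v
        cases (Av , Au , vu) with A⇒ Av | A⇒ Au
        ... | inj₁ refl | _         = inj₂ (≤-trans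
          (𝟙-yes (v ≟ w ×-dec A? u ×-dec adj? j w u) (refl , Au , vu)) (m≤m+n _ _))
        ... | inj₂ _    | inj₁ refl = inj₂ (≤-trans
          (𝟙-yes (u ≟ w ×-dec A? v ×-dec adj? j w v) (refl , Av , adj-sym vu)) (m≤n+m _ _))
        ... | inj₂ A′v  | inj₂ A′u  = inj₁ (A′v , A′u , vu)
      news : (∑ N λ v → ∑ N λ u → new u v) ≤ K
      news = ≤-trans (∑-mono N (λ {v} _ → count-point N w (A? v ×-dec adj? j w v))) deg≤K

    pop-inv : ∀ {c} → Extreme L M → depth c ≢ 0 → Inv c → depth c < 2 + L →
              (∀ {u b} → u < N → b < B → Rejects c u b) → Inv (pop c)
    pop-inv {mkConfig zero _ _ _ _ _ _} _ d≢0 = contradiction refl d≢0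
    pop-inv {c@(mkConfig (suc d) C S X vis ded mrk)} M-extreme _ I (s≤s (s≤s d≤L)) rejects = record
      { depth≤          = ≤-trans (n≤1+n d) depth≤
      ; color<          = color<
      ; vertex<         = vertex< ∘ m<n⇒m<1+n
      ; vertex-visited  = vertex-visited ∘ m<n⇒m<1+n
      ; vertex-alive    = va
      ; vertex-inj      = λ e< f< → vertex-inj (m<n⇒m<1+n e<) (m<n⇒m<1+n f<)
      ; block<          = block< ∘ m<n⇒m<1+n
      ; block-marked    = λ {e} → bm {e}
      ; marked-block    = mb
      ; monochromatic   = monochromatic ∘ m<n⇒m<1+n
      ; visited≤        = visited≤
      ; dead≤           = ded≤
      ; unvisited-alive = ua
      ; alive-visited   = av
      ; budget          = bud
      ; exhausted       = exhausted
      }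
      where
      open Inv I
      w : ℕ
      w = S d
      ded′ mrk′ : ℕ → ℕ
      ded′ = upd ded w (suc C)
      mrk′ = upd mrk (X d) 0
      S≢w : ∀ {e} → e < d → w ≢ S e
      S≢w e<d eq = <⇒≢ e<d (vertex-inj (m<n⇒m<1+n e<d) ≤-refl (sym eq))
      va : ∀ {e} → e < d → ded′ (S e) ≤ C
      va e<d = ≤-trans (≤-reflexive (upd-≢ ded (suc C) (S≢w e<d))) (vertex-alive (m<n⇒m<1+n e<d))
      marked-at : ∀ {e} → 0 < e → e < suc d → mrk (X e) ≡ e ∸ M
      marked-at {suc e} _ = block-marked
      bm : ∀ {e} → suc e < d → mrk′ (X (suc e)) ≡ suc e ∸ M
      bm {e} 1+e<d with X d ≟ X (suc e)
      ... | no x≢ = trans (upd-≢ mrk 0 x≢) (block-marked (m<n⇒m<1+n 1+e<d))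
      ... | yes eq rewrite eq = trans (upd-≡ mrk (X (suc e)) 0) (sym (trans same d∸M≡0))
        where
        same : suc e ∸ M ≡ d ∸ M
        same = trans (sym (marked-at z<s (m<n⇒m<1+n 1+e<d)))
                     (trans (cong mrk (sym eq)) (marked-at (≤-<-trans z≤n 1+e<d) ≤-refl))
        d∸M≡0 : d ∸ M ≡ 0
        d∸M≡0 = extreme-repeat M-extreme 1+e<d (m≤n⇒m≤1+n d≤L) same
      mb : ∀ {x} → mrk′ x ≢ 0 → ∃[ e ] M ≤ e × suc e < d × X (suc e) ≡ x
      mb {x} m≢0 with X d ≟ x
      ... | yes refl = contradiction (upd-≡ mrk x 0) m≢0
      ... | no Xd≢x with marked-block (m≢0 ∘ trans (upd-≢ mrk 0 Xd≢x))
      ...   | e , M≤e , s≤s 1+e≤d , eq = e , M≤e , ≤∧≢⇒< 1+e≤d (λ { refl → Xd≢x eq }) , eq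
      ded≤ : ∀ u → ded′ u ≤ suc C
      ded≤ u with w ≟ u
      ... | yes refl = ≤-reflexive (upd-≡ ded w (suc C))
      ... | no w≢u   = ≤-trans (≤-reflexive (upd-≢ ded (suc C) w≢u)) (dead≤ u)
      w-visited : ¬ vis w ≤ C
      w-visited le = <⇒≱ ≤-refl (≤-trans (≤-reflexive (sym (vertex-visited ≤-refl))) le)
      ua : ∀ {u} → vis u ≤ C → ded′ u ≤ C
      ua {u} v≤ with w ≟ u
      ... | yes refl = contradiction v≤ w-visited
      ... | no w≢u   = ≤-trans (≤-reflexive (upd-≢ ded (suc C) w≢u)) (unvisited-alive v≤)
      w-dead : ¬ ded′ w ≤ C
      w-dead le = <⇒≱ ≤-refl (≤-trans (≤-reflexive (sym (upd-≡ ded w (suc C)))) le)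
      was-alive : ∀ {u} → ded′ u ≤ C → w ≢ u × ded u ≤ C
      was-alive {u} al with w ≟ u
      ... | yes refl = contradiction al w-dead
      ... | no w≢u   = w≢u , ≤-trans (≤-reflexive (sym (upd-≢ ded (suc C) w≢u))) al
      below : ∀ {u} → w ≢ u → ∃[ e ] e < suc d × S e ≡ u → ∃[ e ] e < d × S e ≡ u
      below w≢u (e , s≤s e≤d , refl) = e , ≤∧≢⇒< e≤d (λ { refl → w≢u refl }) , refl
      av : ∀ {u} → ded′ u ≤ C → vis u ≡ suc C → ∃[ e ] e < d × S e ≡ u
      av al v≡ with was-alive al
      ... | w≢u , al₀ = below w≢u (alive-visited al₀ v≡)
      still-alive : ∀ {u} → ded u ≤ C → u ≡ w ⊎ ded′ u ≤ C
      still-alive {u} al with w ≟ u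
      ... | yes refl = inj₁ refl
      ... | no w≢u   = inj₂ (≤-trans (≤-reflexive (upd-≢ ded (suc C) w≢u)) al)
      -- A free block hitting `u` in the current color would have been accepted, so all such blocks
      -- are marked. Their depths are `suc e` with `M ≤ e` and `e < d ≤ L`, so `e ∸ M` takes at most
      -- `L ∸ M` values.
      hits≤ : ∀ {u} → u < N → vis u ≤ C → count B (hits? C w u) ≤ L ∸ M
      hits≤ {u} u<N v≤ = count-cover B (L ∸ M) (λ e → X (suc (e + M))) (hits? C w u) cover
        where
        cover : ∀ {b} → b < B → col w b u ≡ C → ∃[ e ] e < L ∸ M × X (suc (e + M)) ≡ b
        cover {b} b<B hit with mrk b ≟ 0
        ... | yes m≡0 = contradiction (accepts m≡0 v≤ hit) (rejects u<N b<B)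
        ... | no m≢0 with marked-block m≢0
        ...   | e , M≤e , s≤s 1+e≤d , eq =
          e ∸ M , ∸-monoˡ-< (≤-trans 1+e≤d d≤L) M≤e , trans (cong (X ∘ suc) (m∸n+n≡m M≤e)) eq
      -- By `hits≤` no neighbor is unvisited, so a living one is on the path; being different from
      -- the top vertex `w`, it is one of the `d ≤ L` vertices below.
      degree≤ : count N (λ u → alive? c u ×-dec adj? C w u) ≤ L
      degree≤ = count-cover N L S (λ u → alive? c u ×-dec adj? C w u) cover
        where
        cover : ∀ {u} → u < N → Alive c u × Adj C w u → ∃[ e ] e < L × S e ≡ u
        cover {u} u<N (al , w≢u , hits) with m≤n⇒m<n∨m≡n (visited≤ u)
        ... | inj₁ (s≤s v≤) = contradiction (hits≤ u<N v≤) (<⇒≱ hits)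
        ... | inj₂ v≡ with below w≢u (alive-visited al v≡)
        ...   | e , e<d , eq = e , ≤-trans e<d d≤L , eq
      fewer : count N (alive? (pop c)) < count N (alive? c)
      fewer = ∑-mono-< N (λ {u} _ → 𝟙-mono (alive? (pop c) u) (alive? c u) (proj₂ ∘ was-alive)) (vertex< ≤-refl)
        (≤-trans (s≤s (≤-reflexive (𝟙-no (alive? (pop c) w) w-dead))) (𝟙-yes (alive? c w) (vertex-alive ≤-refl)))
      bud : edges C + 2 * L * count N (alive? (pop c)) ≤ edgesOn C (alive? (pop c)) + 2 * L * N
      -- The death of `w` lowers both sides: the right by at most 2L lost pairs, the left by at
      -- least 2L for one living vertex fewer.
      bud = +-cancelʳ-≤ (2 * L) _ _ (begin
        edges C + 2 * L * a′ + 2 * L    ≡⟨ shift₁ (edges C) (2 * L) a′ ⟩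
        edges C + 2 * L * suc a′        ≤⟨ +-monoʳ-≤ (edges C) (*-monoʳ-≤ (2 * L) fewer) ⟩
        edges C + 2 * L * a             ≤⟨ budget ⟩
        edgesOn C (alive? c) + 2 * L * N
          ≤⟨ +-monoˡ-≤ (2 * L * N) (edgesOn-delete C w (alive? c) (alive? (pop c)) still-alive degree≤) ⟩
        edgesOn C (alive? (pop c)) + 2 * L + 2 * L * N
          ≡⟨ shift₂ (edgesOn C (alive? (pop c))) (2 * L) (2 * L * N) ⟩
        edgesOn C (alive? (pop c)) + 2 * L * N + 2 * L ∎)
        where
        open ≤-Reasoning
        a a′ : ℕ
        a  = count N (alive? c)
        a′ = count N (alive? (pop c))
        shift₁ : ∀ x y z → x + y * z + y ≡ x + y * suc z
        shift₁ = solve-∀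
        shift₂ : ∀ x y z → x + y + z ≡ x + z + y
        shift₂ = solve-∀

  -- Pigeonhole over the colors, and the change of color

  module _ (col< : ∀ {v u b} → v < N → u < N → v ≢ u → b < B → col v b u < r)
           (N-large : suc (r * (2 * L)) < N) (B-large : r * (L ∸ M) < B) where

    -- If `v` and `u` were adjacent in no color, each color would occur on at most `L ∸ M` blocks,
    -- accounting for only r(L ∸ M) of the B blocks.
    some-adj : ∀ {v u} → v < N → u < N → v ≢ u → 1 ≤ ∑ r (λ j → 𝟙 (adj? j v u))
    some-adj {v} {u} v<N u<N v≢u with ∑ r (λ j → 𝟙 (adj? j v u)) in none
    ... | suc _ = s≤s z≤n
    ... | zero  = contradiction B≤ (<⇒≱ B-large)
      where
      few : ∀ {j} → j < r → count B (hits? j v u) ≤ L ∸ M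
      few {j} j<r = ≮⇒≥ λ many → <⇒≱ (𝟙-yes (adj? j v u) (v≢u , many))
        (≤-trans (term≤∑ r (λ i → 𝟙 (adj? i v u)) j<r) (≤-reflexive none))
      open ≤-Reasoning
      B≤ : B ≤ r * (L ∸ M)
      B≤ = begin
        B                                         ≡⟨ *-identityʳ B ⟨
        B * 1                                     ≡⟨ ∑-const B 1 ⟨
        ∑ B (const 1)                             ≤⟨ ∑-mono B (λ {b} b<B → ≤-trans (𝟙-yes (hits? (col v b u) v u b) refl)
                                                       (term≤∑ r (λ j → 𝟙 (hits? j v u b)) (col< v<N u<N v≢u b<B))) ⟩
        ∑ B (λ b → ∑ r (λ j → 𝟙 (hits? j v u b)))  ≡⟨ ∑-swap B r (λ b j → 𝟙 (hits? j v u b)) ⟩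
        ∑ r (λ j → count B (hits? j v u))         ≤⟨ ∑-≤-const r few ⟩
        r * (L ∸ M)                               ∎

    -- Of the N² ordered pairs, N are diagonal and every other one is counted in some `edges j`. If
    -- all colors were exhausted, N² would be at most 2rLN + N; cancelling N contradicts `N-large`.
    not-all-exhausted : ¬ (∀ {j} → j < r → edges j ≤ 2 * L * N)
    not-all-exhausted all = <⇒≱ N-large (*-cancelʳ-≤ N (suc (r * (2 * L))) N {{>-nonZero (<-≤-trans z<s N-large)}} (begin
      N * N                                       ≡⟨ ∑-const N N ⟨
      ∑ N (const N)                               ≤⟨ ∑-mono N row ⟩
      (∑ N λ v → ∑ N (deg v) + 1)                 ≡⟨ ∑-+ N (λ v → ∑ N (deg v)) (const 1) ⟩
      (∑ N λ v → ∑ N (deg v)) + ∑ N (const 1)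
        ≡⟨ cong₂ _+_ (∑-cong N λ v → ∑-swap N r (λ u j → 𝟙 (adj? j v u))) (∑-const N 1) ⟩
      (∑ N λ v → ∑ r λ j → count N (adj? j v)) + N * 1  ≡⟨ cong₂ _+_ (∑-swap N r (λ v j → count N (adj? j v))) (*-identityʳ N) ⟩
      ∑ r edges + N                               ≤⟨ +-monoˡ-≤ N (∑-≤-const r all) ⟩
      r * (2 * L * N) + N                         ≡⟨ shift r (2 * L) N ⟩
      suc (r * (2 * L)) * N                       ∎))
      where
      open ≤-Reasoning
      deg : ℕ → ℕ → ℕ
      deg v u = ∑ r (λ j → 𝟙 (adj? j v u))
      shift : ∀ a b c → a * (b * c) + c ≡ suc (a * b) * c
      shift = solve-∀
      row : ∀ {v} → v < N → N ≤ ∑ N (deg v) + 1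
      row {v} v<N = begin
        N                                       ≡⟨ *-identityʳ N ⟨
        N * 1                                   ≡⟨ ∑-const N 1 ⟨
        ∑ N (const 1)                           ≤⟨ ∑-mono N entry ⟩
        ∑ N (λ u → deg v u + 𝟙 (u ≟ v))         ≡⟨ ∑-+ N (deg v) (λ u → 𝟙 (u ≟ v)) ⟩
        ∑ N (deg v) + count N (_≟ v)            ≤⟨ +-monoʳ-≤ (∑ N (deg v)) (count-singleton N v) ⟩
        ∑ N (deg v) + 1                         ∎
        where
        entry : ∀ {u} → u < N → 1 ≤ deg v u + 𝟙 (u ≟ v)
        entry {u} u<N = [ (λ u≡v → ≤-trans (𝟙-yes (u ≟ v) u≡v) (m≤n+m _ _))
                        , (λ u≢v → ≤-trans (some-adj v<N u<N (u≢v ∘ sym)) (m≤m+n _ _)) ]′ (toSum (u ≟ v))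

    -- With an empty path nothing is marked and every color fits, so an unvisited vertex would have
    -- been accepted; a visited living vertex would be on the path. Hence all vertices are dead and
    -- `budget` says that the color is exhausted. Raising the color then turns every `visited` and
    -- `dead` entry into a no.
    nextColor-inv : ∀ {c} → depth c ≡ 0 → Inv c →
                    (∀ {u b} → u < N → b < B → Rejects c u b) → Inv (nextColor c)
    nextColor-inv {c@(mkConfig zero C S X vis ded mrk)} refl I rejects = record
      { depth≤          = z≤n
      ; color<          = next<r
      ; vertex<         = λ ()
      ; vertex-visited  = λ ()
      ; vertex-alive    = λ ()
      ; vertex-inj      = λ ()
      ; block<          = λ ()
      ; block-marked    = λ ()
      ; marked-block    = λ m≢0 → contradiction m≢0 no-mark
      ; monochromatic   = λ ()
      ; visited≤        = m≤n⇒m≤1+n ∘ visited≤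
      ; dead≤           = m≤n⇒m≤1+n ∘ dead≤
      ; unvisited-alive = λ {u} _ → dead≤ u
      ; alive-visited   = λ {u} _ v≡ → contradiction (≤-trans (≤-reflexive (sym v≡)) (visited≤ u)) (<⇒≱ ≤-refl)
      ; budget          = +-mono-≤
          (∑-mono N λ {v} _ → ∑-mono N λ {u} _ → 𝟙-mono (adj? (suc C) v u)
            (alive? (nextColor c) v ×-dec alive? (nextColor c) u ×-dec adj? (suc C) v u)
            (λ vu → dead≤ v , dead≤ u , vu))
          (*-monoʳ-≤ (2 * L) (count≤ N (alive? (nextColor c))))
      ; exhausted       = all-spent
      }
      where
      open Inv I
      no-mark : ∀ {b} → ¬ (mrk b ≢ 0)
      no-mark m≢0 with marked-block m≢0
      ... | _ , _ , () , _
      0<B : 0 < B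
      0<B = ≤-<-trans z≤n B-large
      all-dead : ∀ {u} → u < N → ¬ Alive c u
      all-dead {u} u<N al with m≤n⇒m<n∨m≡n (visited≤ u)
      -- Block 0 serves as a free block. `marked-block` only refutes a nonzero mark, and
      -- decidability of equality yields the zero.
      ... | inj₁ (s≤s v≤) = rejects u<N 0<B (accepts (decidable-stable (mrk 0 ≟ 0) no-mark) v≤ refl)
      ... | inj₂ v≡ with alive-visited al v≡
      ...   | _ , () , _
      spent : edges C ≤ 2 * L * N
      spent = begin
        edges C                                    ≤⟨ m≤m+n _ _ ⟩
        edges C + 2 * L * count N (alive? c)       ≤⟨ budget ⟩
        edgesOn C (alive? c) + 2 * L * N           ≤⟨ +-monoˡ-≤ (2 * L * N) empty ⟩
        2 * L * N                                  ∎
        where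
        open ≤-Reasoning
        empty : edgesOn C (alive? c) ≤ 0
        empty = ≤-trans (∑-≤-const N {c = 0} (λ {v} v<N → ≤-trans (∑-≤-const N {c = 0} (λ {u} _ →
          ≤-reflexive (𝟙-no (alive? c v ×-dec alive? c u ×-dec adj? C v u) (all-dead v<N ∘ proj₁))))
          (≤-reflexive (*-zeroʳ N)))) (≤-reflexive (*-zeroʳ N))
      all-spent : ∀ {j} → j < suc C → edges j ≤ 2 * L * N
      all-spent j<1+C with m<1+n⇒m<n∨m≡n j<1+C
      ... | inj₁ j<C  = exhausted j<C
      ... | inj₂ refl = spent
      next<r : suc C < r
      -- Were this the last color, all colors would now be exhausted.
      next<r = ≤∧≢⇒< color< (λ 1+C≡r → not-all-exhausted (λ {j} j<r → all-spent (subst (j <_) (sym 1+C≡r) j<r)))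

  initial : Config
  initial = mkConfig 0 0 (const 0) (const 0) (const 0) (const 0) (const 0)

  initial-inv : 0 < r → Inv initial
  initial-inv 0<r = record
    { depth≤          = z≤n
    ; color<          = 0<r
    ; vertex<         = λ ()
    ; vertex-visited  = λ ()
    ; vertex-alive    = λ ()
    ; vertex-inj      = λ ()
    ; block<          = λ ()
    ; block-marked    = λ ()
    ; marked-block    = λ 0≢0 → contradiction refl 0≢0
    ; monochromatic   = λ ()
    ; visited≤        = λ _ → z≤n
    ; dead≤           = λ _ → z≤n
    ; unvisited-alive = λ _ → z≤n
    ; alive-visited   = λ _ ()
    ; budget          = +-mono-≤
        (∑-mono N λ {v} _ → ∑-mono N λ {u} _ → 𝟙-mono (adj? 0 v u)
          (alive? initial v ×-dec alive? initial u ×-dec adj? 0 v u) (λ vu → z≤n , z≤n , vu))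
        (*-monoʳ-≤ (2 * L) (count≤ N (alive? initial)))
    ; exhausted       = λ ()
    }

  potential-initial : potential initial ≤ suc r * suc (2 * N)
  potential-initial = begin
    r * suc (2 * N) + (2 * count N (unvisited? initial) + 0)
      ≤⟨ +-monoʳ-≤ (r * suc (2 * N)) (+-monoˡ-≤ 0 (*-monoʳ-≤ 2 (count≤ N (unvisited? initial)))) ⟩
    r * suc (2 * N) + (2 * N + 0)  <⟨ ≤-reflexive (shift r (2 * N)) ⟩
    suc r * suc (2 * N)            ∎
    where
    open ≤-Reasoning
    shift : ∀ a b → suc (a * suc b + (b + 0)) ≡ suc a * suc b
    shift = solve-∀

-- Program logic

-- An upper bound on the running time of a loop-free program; junk on loops.
cost : ℕ → Program → ℕ
cost k skip                    = 1
cost k (a at x ≔ y)            = 1 + evalTime x + evalTime y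
cost k (b ≔color a)            = 1 + k
cost k (p ⨟ q)                 = cost k p + cost k q
cost k (if x then p else q)    = 1 + evalTime x + (cost k p + cost k q)
cost k (while x loop p)        = 0

forEach : ℕ → (ℕ → Program) → Program
forEach zero    p = skip
forEach (suc m) p = forEach m p ⨟ p m

cost-forEach : ∀ m {p c} → (∀ {i} → i < m → cost k (p i) ≤ c) → cost k (forEach m p) ≤ 1 + m * c
cost-forEach zero    p≤c = ≤-refl
cost-forEach {k} (suc m) {p} {c} p≤c = begin
  cost k (forEach m p) + cost k (p m)  ≤⟨ +-mono-≤ (cost-forEach m (λ i<m → p≤c (m<n⇒m<1+n i<m))) (p≤c ≤-refl) ⟩
  1 + m * c + c                        ≡⟨ cong suc (+-comm (m * c) c) ⟩
  1 + (c + m * c)                      ∎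
  where open ≤-Reasoning

-- Sequencing counts in the size but takes no time, hence `suc c` here against `c` in
-- `cost-forEach`.
size-forEach : ∀ m {p c} → (∀ {i} → i < m → size (p i) ≤ c) → size (forEach m p) ≤ 1 + m * suc c
size-forEach zero    p≤c = ≤-refl
size-forEach (suc m) {p} {c} p≤c = begin
  1 + size (forEach m p) + size (p m)  ≤⟨ +-mono-≤ (s≤s (size-forEach m (λ i<m → p≤c (m<n⇒m<1+n i<m)))) (p≤c ≤-refl) ⟩
  2 + m * suc c + c                    ≡⟨ shift (m * suc c) c ⟩
  1 + (suc c + m * suc c)              ∎
  where
  open ≤-Reasoning
  shift : ∀ a c → 2 + a + c ≡ 1 + (suc c + a)
  shift = solve-∀

-- For total correctness, except that loops are never considered correct.
module _ (χ : Coloring (complete k n) r) where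

  wp : Program → (State → Set) → State → Set
  wp skip Q s                 = Q s
  wp (a at x ≔ y) Q s         = Q (s [ a , eval s x ↦ eval s y ])
  wp (b ≔color a) Q s         =
    Σ[ f ∈ (Fin k → Fin n) ] Σ[ inj ∈ Injective _≡_ _≡_ f ]
      (∀ q → s a (toℕ q) ≡ toℕ (f q)) × Q (s [ b , 0 ↦ toℕ (χ (range f) (∣range∣ inj)) ])
  wp (p ⨟ q) Q s              = wp p (wp q Q) s
  wp (if x then p else q) Q s = (eval s x ≢ 0 → wp p Q s) × (eval s x ≡ 0 → wp q Q s)
  wp (while x loop p) Q s     = ⊥

  wp-mono : ∀ p {P Q : State → Set} {s} → (∀ {s′} → P s′ → Q s′) → wp p P s → wp p Q s
  wp-mono skip                 P⇒Q w = P⇒Q w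
  wp-mono (a at x ≔ y)         P⇒Q w = P⇒Q w
  wp-mono (b ≔color a)         P⇒Q (f , inj , eq , w) = f , inj , eq , P⇒Q w
  wp-mono (p ⨟ q)              P⇒Q w = wp-mono p (wp-mono q P⇒Q) w
  wp-mono (if x then p else q) P⇒Q (w , w′) = wp-mono p P⇒Q ∘ w , wp-mono q P⇒Q ∘ w′

  wp-sound : ∀ p {Q s} → wp p Q s → ∃[ t ] ∃[ s′ ] Run χ s p t s′ × Q s′ × t ≤ cost k p
  wp-sound skip         w = _ , _ , skip , w , ≤-refl
  wp-sound (a at x ≔ y) w = _ , _ , assign , w , ≤-refl
  wp-sound (b ≔color a) (f , inj , eq , w) = _ , _ , query f inj eq , w , ≤-refl
  wp-sound (p ⨟ q) w with wp-sound p w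
  ... | t , s′ , run , w′ , t≤ with wp-sound q w′
  ...   | u , s″ , run′ , Qs″ , u≤ = _ , _ , seq run run′ , Qs″ , +-mono-≤ t≤ u≤
  wp-sound (if x then p else q) {s = s} (w , w′) with eval s x ≟ 0
  ... | yes x≡0 with wp-sound q (w′ x≡0)
  ...   | t , s′ , run , Qs′ , t≤ =
    _ , _ , if-no x≡0 run , Qs′ , +-monoʳ-≤ (1 + evalTime x) (≤-trans t≤ (m≤n+m _ _))
  wp-sound (if x then p else q) {s = s} (w , w′) | no x≢0 with wp-sound p (w x≢0)
  ...   | t , s′ , run , Qs′ , t≤ =
    _ , _ , if-yes x≢0 run , Qs′ , +-monoʳ-≤ (1 + evalTime x) (≤-trans t≤ (m≤m+n _ _))

  -- The measure falls in each iteration, so `fuel` bounds their number; the additional summand in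
  -- `suc fuel` pays for the final, failing test.
  while-sound : ∀ x p (I : State → Set) (μ : State → ℕ) →
                (∀ {s} → I s → eval s x ≢ 0 → wp p (λ s′ → I s′ × μ s′ < μ s) s) →
                ∀ fuel {s} → μ s ≤ fuel → I s →
                ∃[ t ] ∃[ s′ ] Run χ s (while x loop p) t s′ × (I s′ × eval s′ x ≡ 0) ×
                               t ≤ suc fuel * (1 + evalTime x + cost k p)
  while-sound x p I μ body fuel {s} μ≤ Is with eval s x ≟ 0
  ... | yes x≡0 = _ , _ , done x≡0 , (Is , x≡0) , ≤-trans (m≤m+n _ _) (m≤m+n _ _)
  ... | no x≢0 with wp-sound p (body Is x≢0)
  ...   | t , s′ , run , (Is′ , μ<) , t≤ with fuel
  ...     | zero = contradiction (<-≤-trans μ< μ≤) λ ()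
  ...     | suc fuel′ with while-sound x p I μ body fuel′ (s≤s⁻¹ (<-≤-trans μ< μ≤)) Is′
  ...       | u , s″ , run′ , post , u≤ =
    _ , _ , loop x≢0 run run′ , post , +-mono-≤ (+-monoʳ-≤ (1 + evalTime x) t≤) u≤

  wp-forEach : ∀ m p (I : ℕ → State → Set) →
               (∀ {i} → i < m → ∀ {s} → I i s → wp (p i) (I (suc i)) s) →
               ∀ {s} → I 0 s → wp (forEach m p) (I m) s
  wp-forEach zero    p I step I0 = I0
  wp-forEach (suc m) p I step I0 =
    wp-mono (forEach m p) (step ≤-refl) (wp-forEach m p I (step ∘ m<n⇒m<1+n) I0)

  -- The observation φ carries whatever must survive the writes to array a.
  wp-fill : ∀ {X : Set} (φ : State → X) a o (e : ℕ → Expr) (h : X → ℕ → ℕ) →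
            (∀ s i v → φ (s [ a , i ↦ v ]) ≡ φ s) → (∀ s j → eval s (e j) ≡ h (φ s) j) →
            ∀ m {s} → wp (forEach m (λ j → a at lit (o + j) ≔ e j))
                         (λ s′ → φ s′ ≡ φ s × (∀ {j} → j < m → s′ a (o + j) ≡ h (φ s) j)) s
  wp-fill φ a o e h frame eval≡ m {s} =
    wp-forEach m _ (λ i s′ → φ s′ ≡ φ s × (∀ {j} → j < i → s′ a (o + j) ≡ h (φ s) j)) step (refl , λ ())
    where
    self : ∀ s i v → (s [ a , i ↦ v ]) a i ≡ v
    self s i v with a ≡ᵇ a | ≡⇒≡ᵇ a a refl
    ... | true | _ = upd-≡ (s a) i v
    other : ∀ s {i} v {j} → i ≢ j → (s [ a , i ↦ v ]) a j ≡ s a j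
    other s v i≢j with a ≡ᵇ a
    ... | true  = upd-≢ (s a) v i≢j
    ... | false = refl
    step : ∀ {i} → i < m → ∀ {s′} → φ s′ ≡ φ s × (∀ {j} → j < i → s′ a (o + j) ≡ h (φ s) j) →
           φ (s′ [ a , o + i ↦ eval s′ (e i) ]) ≡ φ s ×
           (∀ {j} → j < suc i → (s′ [ a , o + i ↦ eval s′ (e i) ]) a (o + j) ≡ h (φ s) j)
    step {i} _ {s′} (φ≡ , filled) = trans (frame s′ (o + i) _) φ≡ , λ {j} → filled′ {j}
      where
      filled′ : ∀ {j} → j < suc i → (s′ [ a , o + i ↦ eval s′ (e i) ]) a (o + j) ≡ h (φ s) j
      filled′ {j} j<1+i with m<1+n⇒m<n∨m≡n j<1+i
      ... | inj₁ j<i  = trans (other s′ _ (<⇒≢ j<i ∘ sym ∘ +-cancelˡ-≡ o _ _)) (filled j<i)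
      ... | inj₂ refl = trans (self s′ (o + i) _) (trans (eval≡ s′ i) (cong (λ x → h x i) φ≡))

-- Edges and colors

∈-image⁺ : ∀ {m} (f : Fin m → Fin n) p {i} → i ∈ p → f i ∈ image f p
∈-image⁺ f (inside  ∷ p) here        = x∈p∪q⁺ (inj₁ (x∈⁅x⁆ (f zero)))
∈-image⁺ f (inside  ∷ p) (there i∈p) = x∈p∪q⁺ (inj₂ (∈-image⁺ (f ∘ suc) p i∈p))
∈-image⁺ f (outside ∷ p) (there i∈p) = ∈-image⁺ (f ∘ suc) p i∈p

image-range : ∀ {m o} (f : Fin m → Fin n) (g : Fin o → Fin m) → image f (range g) ≡ range (f ∘ g)
image-range f g = ⊆-antisym to from
  where
  to : image f (range g) ⊆ range (f ∘ g)
  to x∈ with ∈-image⁻ f (range g) x∈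
  ... | i , i∈ , refl with ∈-image⁻ g ⊤ i∈
  ...   | q , q∈ , refl = ∈-image⁺ (f ∘ g) ⊤ q∈
  from : range (f ∘ g) ⊆ image f (range g)
  from x∈ with ∈-image⁻ (f ∘ g) ⊤ x∈
  ... | q , q∈ , refl = ∈-image⁺ f (range g) (∈-image⁺ g ⊤ q∈)

range-⊆ : ∀ {m o} {f : Fin m → Fin n} {g : Fin o → Fin n} → (∀ i → ∃[ j ] g j ≡ f i) → range f ⊆ range g
range-⊆ {f = f} {g} into x∈ with ∈-image⁻ f ⊤ x∈
... | i , _ , refl with into i
...   | j , gj≡fi = subst (_∈ range g) gj≡fi (∈-image⁺ g ⊤ ∈⊤)

range-cong : ∀ {m} {f g : Fin m → Fin n} → (∀ i → f i ≡ g i) → range f ≡ range g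
range-cong f≗g = ⊆-antisym (range-⊆ λ i → i , sym (f≗g i)) (range-⊆ λ i → i , f≗g i)

module _ {{_ : NonZero n}} where

  -- Reduction modulo n makes the map total, so that bounds on `g` are called for only where its
  -- values matter.
  embed : ∀ {m} → (ℕ → ℕ) → Fin m → Fin n
  embed g q = g (toℕ q) mod n

  toℕ-embed : ∀ {m} (g : ℕ → ℕ) (q : Fin m) → g (toℕ q) < n → toℕ (embed g q) ≡ g (toℕ q)
  toℕ-embed g q g<n = trans (toℕ-fromℕ< (m%n<n (g (toℕ q)) n)) (m<n⇒m%n≡m g<n)

  embed-injective : ∀ {m} {g : ℕ → ℕ} → (∀ {i} → i < m → g i < n) →
                    (∀ {i j} → i < m → j < m → g i ≡ g j → i ≡ j) →
                    Injective _≡_ _≡_ (embed {m} g)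
  embed-injective {g = g} g<n inj {p} {q} eq = toℕ-injective (inj (toℕ<n p) (toℕ<n q) (begin
    g (toℕ p)        ≡⟨ toℕ-embed g p (g<n (toℕ<n p)) ⟨
    toℕ (embed g p)  ≡⟨ cong toℕ eq ⟩
    toℕ (embed g q)  ≡⟨ toℕ-embed g q (g<n (toℕ<n q)) ⟩
    g (toℕ q)        ∎))
    where open ≡-Reasoning

-- Sets that are not edges get the junk color 0.
colorOf : Coloring (complete k n) r → Subset n → ℕ
colorOf {k} χ p with ∣ p ∣ ≟ k
... | yes ∣p∣≡k = toℕ (χ p ∣p∣≡k)
... | no  _     = 0

colorOf-edge : ∀ (χ : Coloring (complete k n) r) p .(∣p∣≡k : ∣ p ∣ ≡ k) → colorOf χ p ≡ toℕ (χ p ∣p∣≡k)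
colorOf-edge {k} χ p ∣p∣≡k with ∣ p ∣ ≟ k
... | yes _ = refl
... | no ¬e = contradiction-irr ∣p∣≡k ¬e

digits-unique : ∀ m .{{_ : NonZero m}} {i j a b} → i < m → j < m → i + a * m ≡ j + b * m → i ≡ j × a ≡ b
digits-unique m {i} {j} {a} {b} i<m j<m eq =
  i≡j , *-cancelʳ-≡ a b m (+-cancelˡ-≡ i _ _ (trans eq (cong (_+ b * m) (sym i≡j))))
  where
  open ≡-Reasoning
  i≡j : i ≡ j
  i≡j = begin
    i                ≡⟨ m<n⇒m%n≡m i<m ⟨
    i % m            ≡⟨ [m+kn]%n≡m%n i a m ⟨
    (i + a * m) % m  ≡⟨ cong (_% m) eq ⟩
    (j + b * m) % m  ≡⟨ [m+kn]%n≡m%n j b m ⟩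
    j % m            ≡⟨ m<n⇒m%n≡m j<m ⟩
    j                ∎

-- The program

-- Array 0 holds the output, array 1 the vertices to be queried, array 2 the
-- answer, array 3 the flag set by a push, and arrays 4 to 10 the fields of a
-- Config in their order.
config : State → Config
config s = mkConfig (s 4 0) (s 5 0) (s 6) (s 7) (s 8) (s 9) (s 10)

-- The machine cannot multiply. When the path is output, its blocks are known only at run time, so
-- their addresses are found by repeated addition; `queryₚ` has its block as a literal.
times : ℕ → Expr → Expr
times zero    x = lit 0
times (suc m) x = x ⊕ times m x

eval-times : ∀ m s x → eval s (times m x) ≡ m * eval s x
eval-times zero    s x = refl
eval-times (suc m) s x = cong (eval s x +_) (eval-times m s x)

module Algorithm (κ L N B M : ℕ) where

  ℓ : ℕ
  ℓ = suc L

  flagₑ answerₑ depthₑ colorₑ : Expr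
  flagₑ   = 3 at lit 0
  answerₑ = 2 at lit 0
  depthₑ  = 4 at lit 0
  colorₑ  = 5 at lit 0

  queryₚ : ℕ → ℕ → Program
  queryₚ u b =
    forEach κ (λ j → 1 at lit (1 + j) ≔ lit (N + κ * b + j)) ⨟
    1 at lit 0 ≔ 6 at (depthₑ ⊖ lit 1) ⨟
    1 at lit (suc κ) ≔ lit u ⨟
    2 ≔color 1

  pushₚ : ℕ → ℕ → Program
  pushₚ u b =
    8 at lit u ≔ lit 1 ⊕ colorₑ ⨟
    6 at depthₑ ≔ lit u ⨟
    7 at depthₑ ≔ lit b ⨟
    10 at lit b ≔ depthₑ ⊖ lit M ⨟
    4 at lit 0 ≔ lit 1 ⊕ depthₑ ⨟
    3 at lit 0 ≔ lit 1

  tryₚ : ℕ → ℕ → Program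
  tryₚ u b =
    if flagₑ ⊕ 10 at lit b ⊕ (8 at lit u ⊖ colorₑ) then skip else
      -- At the root there is nothing to query; the answer is set to the color sought, so the test
      -- that follows succeeds.
      ((if depthₑ then queryₚ u b else (2 at lit 0 ≔ colorₑ)) ⨟
       (if (answerₑ ⊖ colorₑ) ⊕ (colorₑ ⊖ answerₑ) then skip else pushₚ u b))

  scanₚ : Program
  scanₚ = forEach N λ u → forEach B (tryₚ u)

  popₚ : Program
  popₚ =
    -- Lowered first, the depth then indexes the entries of the popped vertex.
    4 at lit 0 ≔ depthₑ ⊖ lit 1 ⨟
    9 at (6 at depthₑ) ≔ lit 1 ⊕ colorₑ ⨟
    10 at (7 at depthₑ) ≔ lit 0

  stepₚ : Program
  stepₚ =
    3 at lit 0 ≔ lit 0 ⨟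
    scanₚ ⨟
    (if flagₑ then skip else
      (if depthₑ then popₚ else (5 at lit 0 ≔ lit 1 ⊕ colorₑ)))

  -- A position on the loose path is read in base κ + 1: digit 0 is a spine vertex, digit `suc j` is
  -- vertex `j` of the block leading to the next spine vertex, hence `suc d`.
  cellₑ : ℕ → ℕ → Expr
  cellₑ d zero    = 6 at lit d
  cellₑ d (suc j) = lit N ⊕ times κ (7 at lit (suc d)) ⊕ lit j

  outputₚ : Program
  outputₚ = forEach (suc κ * ℓ + 1) λ x → 0 at lit x ≔ cellₑ (x / suc κ) (x % suc κ)

  mainₚ : Program
  mainₚ = (while lit (suc ℓ) ⊖ depthₑ loop stepₚ) ⨟ outputₚ

  cell : Config → ℕ → ℕ → ℕ
  cell c d zero    = vertex c d
  cell c d (suc j) = N + κ * block c (suc d) + j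

  eval-cell : ∀ s d q → eval s (cellₑ d q) ≡ cell (config s) d q
  eval-cell s d zero    = refl
  eval-cell s d (suc j) = cong (λ x → N + x + j) (eval-times κ s (7 at lit (suc d)))

  output : Config → ℕ → ℕ
  output c x = cell c (x / suc κ) (x % suc κ)

  -- The vertices of an edge in the order in which the path runs through them.
  edgeCell : ℕ → ℕ → ℕ → ℕ → ℕ
  edgeCell v b u zero    = v
  edgeCell v b u (suc j) = Bool.if does (j <? κ) then N + κ * b + j else u

  edgeCell-block : ∀ v b u {j} → j < κ → edgeCell v b u (suc j) ≡ N + κ * b + j
  edgeCell-block v b u {j} j<κ = cong (λ t → Bool.if t then N + κ * b + j else u) (dec-true (j <? κ) j<κ)

  edgeCell-last : ∀ v b u → edgeCell v b u (suc κ) ≡ u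
  edgeCell-last v b u = cong (λ t → Bool.if t then N + κ * b + κ else u) (dec-false (κ <? κ) (<-irrefl refl))

  output-cell : ∀ c d {q} → q < suc κ → output c (d * suc κ + q) ≡ cell c d q
  output-cell c d {q} q<1+κ with digits-unique (suc κ) {b = d} (m%n<n (d * suc κ + q) (suc κ)) q<1+κ
                               (trans (sym (m≡m%n+[m/n]*n (d * suc κ + q) (suc κ))) (+-comm (d * suc κ) q))
  ... | %≡q , /≡d = cong₂ (cell c) /≡d %≡q

  output-edge : ∀ c d {q} → q < 2 + κ →
                output c (d * suc κ + q) ≡ edgeCell (vertex c d) (block c (suc d)) (vertex c (suc d)) q
  output-edge c d {zero}  _ = output-cell c d z<s
  output-edge c d {suc j} (s≤s j<1+κ) with m<1+n⇒m<n∨m≡n j<1+κ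
  ... | inj₁ j<κ  = trans (output-cell c d (s≤s j<κ)) (sym (edgeCell-block (vertex c d) (block c (suc d)) _ j<κ))
  -- The last vertex of an edge is the first of the next: the digit `suc κ` carries over into `d`.
  ... | inj₂ refl = begin
    output c (d * suc κ + suc κ)  ≡⟨ cong (output c) (trans (+-comm _ (suc κ)) (sym (+-identityʳ _))) ⟩
    output c (suc d * suc κ + 0)  ≡⟨ output-cell c (suc d) z<s ⟩
    vertex c (suc d)              ≡⟨ edgeCell-last (vertex c d) (block c (suc d)) _ ⟨
    edgeCell (vertex c d) (block c (suc d)) (vertex c (suc d)) (suc κ) ∎
    where open ≡-Reasoning

  blockCell-injective : ∀ {b b′ i j} → i < κ → j < κ → N + κ * b + i ≡ N + κ * b′ + j → i ≡ j × b ≡ b′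
  blockCell-injective {b} {b′} {i} {j} i<κ j<κ eq =
    digits-unique κ {{>-nonZero (≤-<-trans z≤n i<κ)}} i<κ j<κ (+-cancelˡ-≡ N _ _ (begin
      N + (i + b * κ)   ≡⟨ shift N i b κ ⟩
      N + κ * b + i     ≡⟨ eq ⟩
      N + κ * b′ + j    ≡⟨ shift N j b′ κ ⟨
      N + (j + b′ * κ)  ∎))
    where
    open ≡-Reasoning
    shift : ∀ n i b k → n + (i + b * k) ≡ n + k * b + i
    shift = solve-∀

  blockCell≥ : ∀ {v b j} → v < N → v < N + κ * b + j
  blockCell≥ v<N = ≤-trans v<N (≤-trans (m≤m+n N _) (m≤m+n _ _))

  edgeCell-injective : ∀ v b u → v < N → u < N → v ≢ u → ∀ {p q} → p < 2 + κ → q < 2 + κ →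
                       edgeCell v b u p ≡ edgeCell v b u q → p ≡ q
  edgeCell-injective v b u v<N u<N v≢u = go
    where
    zero≢suc : ∀ {j} → j < suc κ → v ≢ edgeCell v b u (suc j)
    zero≢suc j<1+κ eq with m<1+n⇒m<n∨m≡n j<1+κ
    ... | inj₁ j<κ  = <⇒≢ (blockCell≥ v<N) (trans eq (edgeCell-block v b u j<κ))
    ... | inj₂ refl = v≢u (trans eq (edgeCell-last v b u))
    go : ∀ {p q} → p < 2 + κ → q < 2 + κ → edgeCell v b u p ≡ edgeCell v b u q → p ≡ q
    go {zero}  {zero}  _ _ _ = refl
    go {zero}  {suc j} _ (s≤s j<) eq = contradiction eq (zero≢suc j<)
    go {suc i} {zero}  (s≤s i<) _ eq = contradiction (sym eq) (zero≢suc i<)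
    go {suc i} {suc j} (s≤s i<) (s≤s j<) eq with m<1+n⇒m<n∨m≡n i< | m<1+n⇒m<n∨m≡n j<
    ... | inj₁ i<κ  | inj₁ j<κ  = cong suc (proj₁ (blockCell-injective {b} {b} i<κ j<κ
                                    (trans (sym (edgeCell-block v b u i<κ)) (trans eq (edgeCell-block v b u j<κ)))))
    ... | inj₁ i<κ  | inj₂ refl = contradiction
      (trans (sym (edgeCell-last v b u)) (trans (sym eq) (edgeCell-block v b u i<κ))) (<⇒≢ (blockCell≥ u<N))
    ... | inj₂ refl | inj₁ j<κ  = contradiction
      (trans (sym (edgeCell-last v b u)) (trans eq (edgeCell-block v b u j<κ))) (<⇒≢ (blockCell≥ u<N))
    ... | inj₂ refl | inj₂ refl = refl

  -- The program carries out the search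

  module _ {n r : ℕ} {{_ : NonZero n}} (χ : Coloring (complete (2 + κ) n) r) (fits-in : N + κ * B ≤ n) where

    edge : ℕ → ℕ → ℕ → Fin (2 + κ) → Fin n
    edge v b u = embed (edgeCell v b u)

    opaque
      edgeColor : ℕ → ℕ → ℕ → ℕ
      edgeColor v b u = colorOf χ (range (edge v b u))

    blockCell< : ∀ {b j} → b < B → j < κ → N + κ * b + j < n
    blockCell< {b} {j} b<B j<κ = begin-strict
      N + κ * b + j    <⟨ +-monoʳ-< (N + κ * b) j<κ ⟩
      N + κ * b + κ    ≡⟨ trans (+-assoc N (κ * b) κ) (cong (N +_) (trans (+-comm (κ * b) κ) (sym (*-suc κ b)))) ⟩
      N + κ * suc b    ≤⟨ +-monoʳ-≤ N (*-monoʳ-≤ κ b<B) ⟩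
      N + κ * B        ≤⟨ fits-in ⟩
      n                ∎
      where open ≤-Reasoning

    N≤n : N ≤ n
    N≤n = ≤-trans (m≤m+n N (κ * B)) fits-in

    edgeCell< : ∀ v b u → v < N → u < N → b < B → ∀ {q} → q < 2 + κ → edgeCell v b u q < n
    edgeCell< v b u v<N u<N b<B {zero} _ = <-≤-trans v<N N≤n
    edgeCell< v b u v<N u<N b<B {suc j} (s≤s j<) with m<1+n⇒m<n∨m≡n j<
    ... | inj₁ j<κ  = ≤-<-trans (≤-reflexive (edgeCell-block v b u j<κ)) (blockCell< b<B j<κ)
    ... | inj₂ refl = ≤-<-trans (≤-reflexive (edgeCell-last v b u)) (<-≤-trans u<N N≤n)

    edgeCell-embeds : ∀ v b u → v < N → u < N → v ≢ u → b < B →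
                      Injective _≡_ _≡_ (edge v b u)
    edgeCell-embeds v b u v<N u<N v≢u b<B =
      embed-injective {n = n} (edgeCell< v b u v<N u<N b<B) (edgeCell-injective v b u v<N u<N v≢u)

    opaque
      unfolding edgeColor

      edgeColor-eq : ∀ v b u (inj : Injective _≡_ _≡_ (edge v b u)) →
                     edgeColor v b u ≡ toℕ (χ (range (edge v b u)) (∣range∣ inj))
      edgeColor-eq v b u inj = colorOf-edge χ (range (edge v b u)) (∣range∣ inj)

      edgeColor-def : ∀ v b u → edgeColor v b u ≡ colorOf χ (range (edge v b u))
      edgeColor-def v b u = refl

      -- Exchanging the two ends permutes the positions within the edge, first with last and the
      -- others fixed, so the vertex set is the same.
      edgeColor-sym : ∀ v b u → edgeColor v b u ≡ edgeColor u b v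
      edgeColor-sym v b u = cong (colorOf χ) (⊆-antisym (range-⊆ (reversed v u)) (range-⊆ (reversed u v)))
        where
        reversed : ∀ v u (i : Fin (2 + κ)) → ∃[ j ] edge u b v j ≡ edge v b u i
        reversed v u zero = fromℕ< {suc κ} ≤-refl , cong (_mod n)
          (trans (cong (edgeCell u b v) (toℕ-fromℕ< {suc κ} ≤-refl)) (edgeCell-last u b v))
        reversed v u (suc i) with m<1+n⇒m<n∨m≡n (toℕ<n i)
        ... | inj₁ i<κ = suc i , cong (_mod n) (trans (edgeCell-block u b v i<κ) (sym (edgeCell-block v b u i<κ)))
        ... | inj₂ i≡κ = zero , cong (_mod n) (sym (trans (cong (edgeCell v b u ∘ suc) i≡κ) (edgeCell-last v b u)))

    edgeColor< : ∀ {v u b} → v < N → u < N → v ≢ u → b < B → edgeColor v b u < r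
    edgeColor< {v} {u} {b} v<N u<N v≢u b<B =
      ≤-<-trans (≤-reflexive (edgeColor-eq v b u (edgeCell-embeds v b u v<N u<N v≢u b<B))) (toℕ<n _)

    open Search N B r L M edgeColor

    branchColor-root : ∀ {c u b} → depth c ≡ 0 → branchColor c u b ≡ color c
    branchColor-root {mkConfig zero _ _ _ _ _ _} _ = refl

    branchColor-top : ∀ {c u b} → depth c ≢ 0 → branchColor c u b ≡ edgeColor (vertex c (depth c ∸ 1)) b u
    branchColor-top {mkConfig zero    _ _ _ _ _ _} d≢0 = contradiction refl d≢0
    branchColor-top {mkConfig (suc _) _ _ _ _ _ _} _   = refl

    top< : ∀ {c} → depth c ≢ 0 → depth c ∸ 1 < depth c
    top< {mkConfig zero    _ _ _ _ _ _} d≢0 = contradiction refl d≢0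
    top< {mkConfig (suc _) _ _ _ _ _ _} _   = ≤-refl

    query-wp : ∀ {s u b Q} → let v = s 6 (s 4 0 ∸ 1) in v < N → u < N → v ≢ u → b < B →
               (∀ {s′} → config s′ ≡ config s → s′ 3 0 ≡ s 3 0 → s′ 2 0 ≡ edgeColor v b u → Q s′) →
               wp χ (queryₚ u b) Q s
    query-wp {s} {u} {b} {Q} v<N u<N v≢u b<B post =
      wp-mono χ (forEach κ (λ j → 1 at lit (1 + j) ≔ lit (N + κ * b + j))) asked
        (wp-fill χ (λ s → config s , s 3 0) 1 1 (λ j → lit (N + κ * b + j)) (λ _ j → N + κ * b + j)
                 (λ _ _ _ → refl) (λ _ _ → refl) κ)
      where
      v : ℕ
      v = s 6 (s 4 0 ∸ 1)
      g : ℕ → ℕ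
      g = edgeCell v b u
      inj : Injective _≡_ _≡_ (edge v b u)
      inj = edgeCell-embeds v b u v<N u<N v≢u b<B
      asked : ∀ {s₁} → (config s₁ , s₁ 3 0) ≡ (config s , s 3 0) × (∀ {j} → j < κ → s₁ 1 (1 + j) ≡ N + κ * b + j) →
              wp χ (1 at lit 0 ≔ 6 at (depthₑ ⊖ lit 1) ⨟ 1 at lit (suc κ) ≔ lit u ⨟ 2 ≔color 1) Q s₁
      asked {s₁} (same , filled) =
        edge v b u , inj , matches , post (cong proj₁ same) (cong proj₂ same) (sym (edgeColor-eq v b u inj))
        where
        cells : ∀ {q} → q < 2 + κ →
                (s₁ [ 1 , 0 ↦ s₁ 6 (s₁ 4 0 ∸ 1) ] [ 1 , suc κ ↦ u ]) 1 q ≡ g q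
        cells {zero} _ = cong (λ (c , _) → vertex c (depth c ∸ 1)) same
        cells {suc j} (s≤s j<1+κ) with m<1+n⇒m<n∨m≡n j<1+κ
        ... | inj₁ j<κ  = trans (upd-≢ (λ i → s₁ 1 (suc i)) u (>⇒≢ j<κ)) (trans (filled j<κ) (sym (edgeCell-block v b u j<κ)))
        ... | inj₂ refl = trans (upd-≡ (λ i → s₁ 1 (suc i)) κ u) (sym (edgeCell-last v b u))
        matches : ∀ (q : Fin (2 + κ)) →
                  (s₁ [ 1 , 0 ↦ s₁ 6 (s₁ 4 0 ∸ 1) ] [ 1 , suc κ ↦ u ]) 1 (toℕ q) ≡ toℕ (edge v b u q)
        matches q = trans (cells (toℕ<n q)) (sym (toℕ-embed g q (edgeCell< v b u v<N u<N b<B (toℕ<n q))))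

    -- Rejections refer to the configuration `c` from before the scan. The flag separates the case
    -- where it is still current from the case of a single push, after which the remaining attempts
    -- do nothing.
    Searching : Config → Set → State → Set
    Searching c P s = (s 3 0 ≡ 0 × config s ≡ c × P) ⊎
      (s 3 0 ≢ 0 × ∃[ u ] ∃[ b ] u < N × b < B × Accepts c u b × config s ≡ push M u b c)

    Searching-map : ∀ {c s} {P Q : Set} → (P → Q) → Searching c P s → Searching c Q s
    Searching-map P→Q (inj₁ (flag , same , p)) = inj₁ (flag , same , P→Q p)
    Searching-map P→Q (inj₂ found)             = inj₂ found

    try-wp : ∀ {c u b s} {P : Set} → Inv c → u < N → b < B → Searching c P s →
             wp χ (tryₚ u b) (Searching c (P × Rejects c u b)) s
    try-wp I u<N b<B (inj₂ found@(flag≢0 , _)) =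
      (λ _ → inj₂ found) ,
      (λ eq → contradiction (m+n≡0⇒m≡0 _ (m+n≡0⇒m≡0 _ eq)) flag≢0)
    try-wp {u = u} {b} {s} {P} I u<N b<B (inj₁ (flag≡0 , refl , p)) = passed , tested
      where
      c : Config
      c = config s
      open Inv I
      passed : s 3 0 + s 10 b + (s 8 u ∸ s 5 0) ≢ 0 → Searching c (P × Rejects c u b) s
      passed ≢0 = inj₁ (flag≡0 , refl , p , λ (accepts m≡0 v≤ _) →
        ≢0 (cong₂ _+_ (cong₂ _+_ flag≡0 m≡0) (m≤n⇒m∸n≡0 v≤)))
      tested : s 3 0 + s 10 b + (s 8 u ∸ s 5 0) ≡ 0 →
               wp χ ((if depthₑ then queryₚ u b else (2 at lit 0 ≔ colorₑ)) ⨟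
                     (if (answerₑ ⊖ colorₑ) ⊕ (colorₑ ⊖ answerₑ) then skip else pushₚ u b))
                  (Searching c (P × Rejects c u b)) s
      tested eq = asked , at-root
        where
        m≡0 : s 10 b ≡ 0
        m≡0 = m+n≡0⇒n≡0 (s 3 0) (m+n≡0⇒m≡0 _ eq)
        v≤ : s 8 u ≤ s 5 0
        v≤ = m∸n≡0⇒m≤n (m+n≡0⇒n≡0 (s 3 0 + s 10 b) eq)
        decide : ∀ {s′} → config s′ ≡ c → s′ 3 0 ≡ s 3 0 → s′ 2 0 ≡ branchColor c u b →
                 wp χ (if (answerₑ ⊖ colorₑ) ⊕ (colorₑ ⊖ answerₑ) then skip else pushₚ u b)
                      (Searching c (P × Rejects c u b)) s′
        decide {s′} same flag answer = differs , agrees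
          where
          color≡ : s′ 5 0 ≡ color c
          color≡ = cong color same
          differs : (s′ 2 0 ∸ s′ 5 0) + (s′ 5 0 ∸ s′ 2 0) ≢ 0 → Searching c (P × Rejects c u b) s′
          differs ≢0 = inj₁ (trans flag flag≡0 , same , p , λ (accepts _ _ fits) →
            let agree = trans answer (trans fits (sym color≡)) in
            ≢0 (cong₂ _+_ (m≤n⇒m∸n≡0 (≤-reflexive agree)) (m≤n⇒m∸n≡0 (≤-reflexive (sym agree)))))
          agrees : (s′ 2 0 ∸ s′ 5 0) + (s′ 5 0 ∸ s′ 2 0) ≡ 0 → wp χ (pushₚ u b) (Searching c (P × Rejects c u b)) s′
          agrees ≡0 = inj₂ ((λ ()) , u , b , u<N , b<B ,
            accepts m≡0 v≤ (trans (sym answer) (trans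
              (≤-antisym (m∸n≡0⇒m≤n (m+n≡0⇒m≡0 _ ≡0)) (m∸n≡0⇒m≤n (m+n≡0⇒n≡0 (s′ 2 0 ∸ s′ 5 0) ≡0))) color≡)) ,
            cong (push M u b) same)
        asked : s 4 0 ≢ 0 → _
        -- A query with a repeated vertex would be stuck. The top of the path is visited in the
        -- current color and `u` is not, so they differ.
        asked d≢0 = query-wp (vertex< (top< {c} d≢0)) u<N
          (λ v≡u → <⇒≱ ≤-refl (≤-trans (≤-reflexive (trans (sym (vertex-visited (top< {c} d≢0))) (cong (s 8) v≡u))) v≤))
          b<B (λ {s′} same flag answer → decide {s′} same flag (trans answer (sym (branchColor-top {c} d≢0))))
        at-root : s 4 0 ≡ 0 → _
        at-root d≡0 = decide {s [ 2 , 0 ↦ s 5 0 ]} refl refl (sym (branchColor-root {c} d≡0))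

    Rejected : Config → ℕ → Set
    Rejected c i = ∀ u b → u < i → b < B → Rejects c u b

    RejectedInRow : Config → ℕ → ℕ → Set
    RejectedInRow c i j = ∀ b → b < j → Rejects c i b

    Rejected-suc : ∀ {c i} → Rejected c i × RejectedInRow c i B → Rejected c (suc i)
    Rejected-suc (old , new) u b u<1+i b<B with m<1+n⇒m<n∨m≡n u<1+i
    ... | inj₁ u<i  = old u b u<i b<B
    ... | inj₂ refl = new b b<B

    RejectedInRow-suc : ∀ {c i j} → (Rejected c i × RejectedInRow c i j) × Rejects c i j →
                        Rejected c i × RejectedInRow c i (suc j)
    RejectedInRow-suc {c} {i} {j} ((old , new) , rej) = old , new′
      where
      new′ : RejectedInRow c i (suc j)
      new′ b b<1+j with m<1+n⇒m<n∨m≡n b<1+j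
      ... | inj₁ b<j  = new b b<j
      ... | inj₂ refl = rej

    row-wp : ∀ {c s i} → Inv c → i < N → Searching c (Rejected c i) s →
             wp χ (forEach B (tryₚ i)) (Searching c (Rejected c (suc i))) s
    row-wp {c} {s} {i} I i<N searching =
      wp-mono χ (forEach B (tryₚ i)) (λ {s′} → Searching-map {c} {s′} Rejected-suc)
        (wp-forEach χ B (tryₚ i) (λ j → Searching c (Rejected c i × RejectedInRow c i j))
          (λ {j} j<B {s′} searching′ → wp-mono χ (tryₚ i j) (λ {s″} → Searching-map {c} {s″} RejectedInRow-suc)
            (try-wp {c} {i} {j} {s′} I i<N j<B searching′))
          (Searching-map {c} {s} (λ old → old , λ _ ()) searching))

    scan-wp : ∀ {c s} → Inv c → Searching c 𝟏 s → wp χ scanₚ (Searching c (Rejected c N)) s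
    scan-wp {c} {s} I searching =
      wp-forEach χ N (λ u → forEach B (tryₚ u)) (λ i → Searching c (Rejected c i))
        (λ {i} i<N {s′} → row-wp {c} {s′} {i} I i<N) (Searching-map {c} {s} (λ _ _ _ ()) searching)

    module _ (M-extreme : Extreme L M) (N-large : suc (r * (2 * L)) < N) (B-large : r * (L ∸ M) < B) where

      -- The configuration after the step is `push`, `pop` or `nextColor` of the old one: a set flag
      -- means a push, a clear flag means that all pairs were rejected, and then the depth decides
      -- between the other two.
      step-wp : ∀ {s} → Inv (config s) → eval s (lit (suc ℓ) ⊖ depthₑ) ≢ 0 →
                wp χ stepₚ (λ s′ → Inv (config s′) × potential (config s′) < potential (config s)) s
      step-wp {s} I running =
        wp-mono χ scanₚ (λ {s₁} → advance {s₁}) (scan-wp {c} {s [ 3 , 0 ↦ 0 ]} I (inj₁ (refl , refl , tt)))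
        where
        c : Config
        c = config s
        depth< : depth c < 2 + L
        depth< = ≰⇒> (running ∘ m≤n⇒m∸n≡0)
        Goal : Config → Set
        Goal c′ = Inv c′ × potential c′ < potential c
        advance : ∀ {s₁} → Searching c (Rejected c N) s₁ →
                  wp χ (if flagₑ then skip else
                         (if depthₑ then popₚ else (5 at lit 0 ≔ lit 1 ⊕ colorₑ))) (Goal ∘ config) s₁
        advance (inj₂ (flag≢0 , u , b , u<N , b<B , acc , same)) =
          (λ _ → subst Goal (sym same) (push-inv M-extreme I depth< u<N b<B acc , push-potential {c} u<N acc)) ,
          (λ flag≡0 → contradiction flag≡0 flag≢0)
        advance (inj₁ (flag≡0 , same , rejects)) =
          (λ flag≢0 → contradiction flag≡0 flag≢0) ,
          (λ _ →
            (λ d≢0 → subst (Goal ∘ pop) (sym same)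
              (let d≢0′ = d≢0 ∘ trans (cong depth same) in
               pop-inv edgeColor-sym M-extreme d≢0′ I depth< (rejects _ _) , pop-potential {c} d≢0′)) ,
            (λ d≡0 → subst (Goal ∘ nextColor) (sym same)
              (let d≡0′ = trans (sym (cong depth same)) d≡0 in
               nextColor-inv edgeColor< N-large B-large d≡0′ I (rejects _ _) ,
               nextColor-potential d≡0′ I)))

-- The output is a monochromatic copy

module Correctness (κ L N B M : ℕ) {n r : ℕ} {{_ : NonZero n}} (χ : Coloring (complete (2 + κ) n) r)
                   (fits-in : N + κ * B ≤ n) (disjoint : κ ≡ 0 ⊎ M ≡ 0) where
  open Algorithm κ L N B M
  open Search N B r L M (edgeColor χ fits-in)

  length : ℕ
  length = suc κ * ℓ + 1

  -- The path has one more spine vertex than blocks, so `d ≡ ℓ` occurs with digit 0 only.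
  Position : ℕ → ℕ → Set
  Position d zero    = d < suc ℓ
  Position d (suc j) = d < ℓ × j < κ

  position : ∀ {x} → x < length → Position (x / suc κ) (x % suc κ)
  position {x} x< = go (x / suc κ) (x % suc κ) (m%n<n x (suc κ)) (subst (_≤ ℓ * suc κ) (m≡m%n+[m/n]*n x (suc κ)) x≤)
    where
    x≤ : x ≤ ℓ * suc κ
    x≤ = ≤-trans (s≤s⁻¹ (≤-trans x< (≤-reflexive (+-comm (suc κ * ℓ) 1)))) (≤-reflexive (*-comm (suc κ) ℓ))
    go : ∀ d q → q < suc κ → q + d * suc κ ≤ ℓ * suc κ → Position d q
    go d zero    _         le = s≤s (*-cancelʳ-≤ d ℓ (suc κ) le)
    go d (suc j) (s≤s j<κ) le = *-cancelʳ-< (suc κ) d ℓ (≤-trans (s≤s (m≤n+m _ j)) le) , j<κ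

  module _ {c : Config} (I : Inv c) (complete-path : suc ℓ ≤ depth c) where
    open Inv I

    cell< : ∀ d q → Position d q → cell c d q < n
    cell< d zero    d<         = <-≤-trans (vertex< (≤-trans d< complete-path)) (N≤n χ fits-in)
    cell< d (suc j) (d< , j<κ) = blockCell< χ fits-in (block< (≤-trans (s≤s d<) complete-path)) j<κ

    -- A nonempty block forces `M ≡ 0`; then the mark of a block is its depth and cannot take two
    -- values.
    block-injective : ∀ {d e j} → d < ℓ → e < ℓ → j < κ → block c (suc d) ≡ block c (suc e) → d ≡ e
    block-injective {d} {e} d< e< j<κ eq = suc-injective (begin
      suc d                     ≡⟨ cong (suc d ∸_) M≡0 ⟨
      suc d ∸ M                 ≡⟨ block-marked (≤-trans (s≤s d<) complete-path) ⟨
      marked c (block c (suc d)) ≡⟨ cong (marked c) eq ⟩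
      marked c (block c (suc e)) ≡⟨ block-marked (≤-trans (s≤s e<) complete-path) ⟩
      suc e ∸ M                 ≡⟨ cong (suc e ∸_) M≡0 ⟩
      suc e                     ∎)
      where
      open ≡-Reasoning
      M≡0 : M ≡ 0
      M≡0 = [ (λ κ≡0 → contradiction (≤-trans j<κ (≤-reflexive κ≡0)) λ ()) , id ]′ disjoint

    cell-injective : ∀ d e p q → Position d p → Position e q → cell c d p ≡ cell c e q → p ≡ q × d ≡ e
    cell-injective d e zero    zero    d< e< eq =
      refl , vertex-inj (≤-trans d< complete-path) (≤-trans e< complete-path) eq
    cell-injective d e zero    (suc j) d< _  eq =
      contradiction eq (<⇒≢ (blockCell≥ (vertex< (≤-trans d< complete-path))))
    cell-injective d e (suc i) zero    _  e< eq =
      contradiction (sym eq) (<⇒≢ (blockCell≥ (vertex< (≤-trans e< complete-path))))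
    cell-injective d e (suc i) (suc j) (d< , i<κ) (e< , j<κ) eq with blockCell-injective i<κ j<κ eq
    ... | i≡j , same = cong suc i≡j , block-injective d< e< i<κ same

    output-injective : ∀ {x y} → x < length → y < length → output c x ≡ output c y → x ≡ y
    output-injective {x} {y} x< y< eq
      with cell-injective (x / suc κ) (y / suc κ) (x % suc κ) (y % suc κ) (position x<) (position y<) eq
    ... | %≡ , /≡ = begin
      x                               ≡⟨ m≡m%n+[m/n]*n x (suc κ) ⟩
      x % suc κ + x / suc κ * suc κ   ≡⟨ cong₂ (λ q d → q + d * suc κ) %≡ /≡ ⟩
      y % suc κ + y / suc κ * suc κ   ≡⟨ m≡m%n+[m/n]*n y (suc κ) ⟨
      y                               ∎
      where open ≡-Reasoning

    output< : ∀ {x} → x < length → output c x < n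
    output< {x} x< = cell< (x / suc κ) (x % suc κ) (position x<)

    copy : Fin length → Fin n
    copy = embed (output c)

    copy-edge : ∀ (i : Fin ℓ) → image copy (range (pathVertex (2 + κ) ℓ i)) ≡
      range (edge χ fits-in (vertex c (toℕ i)) (block c (suc (toℕ i))) (vertex c (suc (toℕ i))))
    copy-edge i = trans (image-range copy (pathVertex (2 + κ) ℓ i)) (range-cong λ q → cong (_mod n)
      (trans (cong (output c) (toℕ-fromℕ< (pathVertex-< (2 + κ) ℓ i q))) (output-edge c (toℕ i) (toℕ<n q))))

    copy-monochromatic : IsMonochromaticCopy (loosePath (2 + κ) ℓ) χ copy
    copy-monochromatic = record
      { injective     = copy-injective
      ; color         = fromℕ< color<
      ; monochromatic = λ { _ (i , refl) → toℕ-injective (begin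
          toℕ (χ (image copy (range (pathVertex (2 + κ) ℓ i))) _)
            ≡⟨ colorOf-edge χ (image copy (range (pathVertex (2 + κ) ℓ i)))
                 (trans (∣image∣ copy-injective (range (pathVertex (2 + κ) ℓ i)))
                        (∣range∣ (pathVertex-injective (2 + κ) ℓ i))) ⟨
          colorOf χ (image copy (range (pathVertex (2 + κ) ℓ i)))
            ≡⟨ cong (colorOf χ) (copy-edge i) ⟩
          colorOf χ (range (edge χ fits-in (vertex c (toℕ i)) (block c (suc (toℕ i))) (vertex c (suc (toℕ i)))))
            ≡⟨ edgeColor-def χ fits-in _ _ _ ⟨
          edgeColor χ fits-in (vertex c (toℕ i)) (block c (suc (toℕ i))) (vertex c (suc (toℕ i)))
            ≡⟨ monochromatic (≤-trans (s≤s (toℕ<n i)) complete-path) ⟩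
          color c
            ≡⟨ toℕ-fromℕ< color< ⟨
          toℕ (fromℕ< color<) ∎) }
      }
      where
      open ≡-Reasoning
      copy-injective : Injective _≡_ _≡_ copy
      copy-injective = embed-injective {n = n} output< output-injective

  -- The initial potential bounds the number of iterations, one more factor covers the final test,
  -- and a test takes 5 steps.
  loop-time : ℕ
  loop-time = suc (suc r * suc (2 * N)) * (5 + cost (2 + κ) stepₚ)

  searchₚ : Program
  searchₚ = while lit (suc ℓ) ⊖ depthₑ loop stepₚ

  Found : State → Set
  Found s = Inv (config s) × suc ℓ ≤ depth (config s)

  search-run : 0 < r → Extreme L M → suc (r * (2 * L)) < N → r * (L ∸ M) < B →
               ∃[ t ] ∃[ s ] Run χ (λ _ _ → 0) searchₚ t s × Found s × t ≤ loop-time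
  search-run 0<r M-extreme N-large B-large = exit
    (while-sound χ (lit (suc ℓ) ⊖ depthₑ) stepₚ (λ s → Inv (config s)) (λ s → potential (config s))
      (λ {s} → step-wp χ fits-in M-extreme N-large B-large {s}) (suc r * suc (2 * N)) {λ _ _ → 0}
      potential-initial (initial-inv 0<r))
    where
    exit : (∃[ t ] ∃[ s ] Run χ (λ _ _ → 0) searchₚ t s ×
             (Inv (config s) × eval s (lit (suc ℓ) ⊖ depthₑ) ≡ 0) × t ≤ loop-time) →
           ∃[ t ] ∃[ s ] Run χ (λ _ _ → 0) searchₚ t s × Found s × t ≤ loop-time
    exit (t , s , run , (I , stop) , t≤) = t , s , run , (I , m∸n≡0⇒m≤n stop) , t≤

  Outputs : State → Set
  Outputs = OutputsMonochromaticCopy (loosePath (2 + κ) ℓ) χ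

  output-run : ∀ {s} → Found s →
               ∃[ t ] ∃[ s′ ] Run χ s outputₚ t s′ × Outputs s′ × t ≤ cost (2 + κ) outputₚ
  output-run {s} (I , full) = wp-sound χ outputₚ {Outputs}
    (wp-mono χ outputₚ {Written} {Outputs} (λ {s′} → outputs {s′})
      (wp-fill χ config 0 0 (λ x → cellₑ (x / suc κ) (x % suc κ)) output
        (λ _ _ _ → refl) (λ s x → eval-cell s (x / suc κ) (x % suc κ)) length))
    where
    Written : State → Set
    Written s′ = config s′ ≡ config s × (∀ {x} → x < length → s′ 0 x ≡ output (config s) x)
    outputs : ∀ {s′} → Written s′ → Outputs s′
    outputs (_ , filled) = copy I full , copy-monochromatic I full , λ v →
      trans (filled (toℕ<n v)) (sym (toℕ-embed (output (config s)) v (output< I full (toℕ<n v))))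

  main-run : 0 < r → Extreme L M → suc (r * (2 * L)) < N → r * (L ∸ M) < B →
             ∃[ t ] ∃[ s ] Run χ (λ _ _ → 0) mainₚ t s × Outputs s × t ≤ loop-time + cost (2 + κ) outputₚ
  main-run 0<r M-extreme N-large B-large = append (search-run 0<r M-extreme N-large B-large)
    where
    append : (∃[ t ] ∃[ s ] Run χ (λ _ _ → 0) searchₚ t s × Found s × t ≤ loop-time) →
             ∃[ t ] ∃[ s ] Run χ (λ _ _ → 0) mainₚ t s × Outputs s × t ≤ loop-time + cost (2 + κ) outputₚ
    append (t , s , run , found , t≤) = append′ (output-run found)
      where
      append′ : (∃[ u ] ∃[ s′ ] Run χ s outputₚ u s′ × Outputs s′ × u ≤ cost (2 + κ) outputₚ) →
                ∃[ t ] ∃[ s ] Run χ (λ _ _ → 0) mainₚ t s × Outputs s × t ≤ loop-time + cost (2 + κ) outputₚ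
      append′ (u , s′ , run′ , outputs , u≤) = t + u , s′ , seq run run′ , outputs , +-mono-≤ t≤ u≤

-- Size and running time

evalTime-times : ∀ m x → evalTime (times m x) ≡ 1 + m * (1 + evalTime x)
evalTime-times zero    x = refl
evalTime-times (suc m) x = begin
  1 + evalTime x + evalTime (times m x)        ≡⟨ cong (1 + evalTime x +_) (evalTime-times m x) ⟩
  1 + evalTime x + (1 + m * (1 + evalTime x))  ≡⟨ shift (evalTime x) m ⟩
  1 + suc m * (1 + evalTime x)                 ∎
  where
  open ≡-Reasoning
  shift : ∀ t m → 1 + t + (1 + m * (1 + t)) ≡ 1 + suc m * (1 + t)
  shift = solve-∀

exprSize-times : ∀ m x → exprSize (times m x) ≡ 1 + m * (1 + exprSize x)
exprSize-times zero    x = refl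
exprSize-times (suc m) x = begin
  1 + exprSize x + exprSize (times m x)        ≡⟨ cong (1 + exprSize x +_) (exprSize-times m x) ⟩
  1 + exprSize x + (1 + m * (1 + exprSize x))  ≡⟨ shift (exprSize x) m ⟩
  1 + suc m * (1 + exprSize x)                 ∎
  where
  open ≡-Reasoning
  shift : ∀ t m → 1 + t + (1 + m * (1 + t)) ≡ 1 + suc m * (1 + t)
  shift = solve-∀

module Cost (κ L N B M n : ℕ)
             (fits-in : N + κ * B ≤ n) (path-fits : suc κ * suc L + 1 ≤ n) (B≤n : B ≤ n) (M≤n : M ≤ n)
             (0<N : 0 < N) (0<B : 0 < B) where
  open Algorithm κ L N B M

  0<n : 0 < n
  0<n = ≤-trans (≤-trans 0<N (m≤m+n N _)) fits-in

  spine≤n : N ≤ n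
  spine≤n = m+n≤o⇒m≤o N fits-in

  κ≤n : κ ≤ n
  κ≤n = ≤-trans (≤-trans (m≤m*n κ B {{>-nonZero 0<B}}) (m≤n+m (κ * B) N)) fits-in

  block-start< : ∀ {b j} → b < B → j < κ → N + κ * b + j ≤ n
  block-start< {b} {j} b<B j<κ = begin
    N + κ * b + j    ≤⟨ +-monoʳ-≤ (N + κ * b) (<⇒≤ j<κ) ⟩
    N + κ * b + κ    ≡⟨ shift N κ b ⟩
    N + κ * suc b    ≤⟨ +-monoʳ-≤ N (*-monoʳ-≤ κ b<B) ⟩
    N + κ * B        ≤⟨ fits-in ⟩
    n                ∎
    where
    open ≤-Reasoning
    shift : ∀ a k b → a + k * b + k ≡ a + k * suc b
    shift = solve-∀

  try-size : ∀ {u b} → u < N → b < B → size (tryₚ u b) ≤ 64 * ((2 + κ) * n)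
  try-size {u} {b} u<N b<B = begin
    size (tryₚ u b)
      -- Outside the filling of the block cells, the literal `u` occurs four times, `b` three times,
      -- `M` and `suc κ` once each; the rest is constant.
      ≡⟨ shape (size fill) u b ⟩
    size fill + (87 + 4 * u + 3 * b + M + κ)
      ≤⟨ +-mono-≤ (size-forEach κ (λ {j} j<κ → entry j<κ)) (+-mono-≤ (+-mono-≤ (+-mono-≤ (+-mono-≤
           (*-monoʳ-≤ 87 0<n) (*-monoʳ-≤ 4 (≤-trans (<⇒≤ u<N) spine≤n))) (*-monoʳ-≤ 3 (≤-trans (<⇒≤ b<B) B≤n))) M≤n) κ≤n) ⟩
    1 + κ * suc (4 + 2 * n) + (87 * n + 4 * n + 3 * n + n + n)
      ≡⟨ total κ n ⟩
    1 + (κ * 5 + 2 * (κ * n) + 96 * n)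
      ≤⟨ +-mono-≤ 0<n (+-monoˡ-≤ (96 * n) (+-monoˡ-≤ (2 * (κ * n))
           (≤-trans (≤-reflexive (*-comm κ 5)) (*-monoʳ-≤ 5 (m≤m*n κ n {{>-nonZero 0<n}}))))) ⟩
    n + (5 * (κ * n) + 2 * (κ * n) + 96 * n)
      ≤⟨ m≤m+n _ (31 * n + 57 * (κ * n)) ⟩
    n + (5 * (κ * n) + 2 * (κ * n) + 96 * n) + (31 * n + 57 * (κ * n))
      ≡⟨ total′ κ n ⟩
    64 * ((2 + κ) * n) ∎
    where
    open ≤-Reasoning
    fill : Program
    fill = forEach κ (λ j → 1 at lit (1 + j) ≔ lit (N + κ * b + j))
    entry : ∀ {j} → j < κ → 1 + (1 + (1 + j)) + (1 + (N + κ * b + j)) ≤ 4 + 2 * n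
    entry {j} j<κ = begin
      1 + (1 + (1 + j)) + (1 + (N + κ * b + j))
        ≤⟨ +-mono-≤ (+-monoʳ-≤ 3 (≤-trans (<⇒≤ j<κ) κ≤n)) (+-monoʳ-≤ 1 (block-start< b<B j<κ)) ⟩
      3 + n + (1 + n)  ≡⟨ twice n ⟩
      4 + 2 * n        ∎
      where
      twice : ∀ n → 3 + n + (1 + n) ≡ 4 + 2 * n
      twice = solve-∀
    total : ∀ κ n → 1 + κ * suc (4 + 2 * n) + (87 * n + 4 * n + 3 * n + n + n) ≡ 1 + (κ * 5 + 2 * (κ * n) + 96 * n)
    total = solve-∀
    total′ : ∀ κ n → n + (5 * (κ * n) + 2 * (κ * n) + 96 * n) + (31 * n + 57 * (κ * n)) ≡ 64 * ((2 + κ) * n)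
    total′ = solve-∀
    shape : ∀ F u b → 1 + (1 + (1 + 2 + (1 + (1 + b))) + (1 + (1 + (1 + u)) + 2)) + 1 +
      (1 + (1 + 2 + (1 + F + (1 + (1 + 1 + 6) + (1 + (1 + (1 + suc κ) + (1 + u)) + 1))) + 4)
         + (1 + 11 + 1 +
            (1 + (1 + (1 + u) + 5) + (1 + (1 + 2 + (1 + u)) + (1 + (1 + 2 + (1 + b)) +
              (1 + (1 + (1 + b) + (1 + 2 + (1 + M))) + (1 + 7 + 4)))))))
      ≡ F + (87 + 4 * u + 3 * b + M + κ)
    shape F u b = identity κ M F u b
      where
      identity : ∀ κ M F u b → 1 + (1 + (1 + 2 + (1 + (1 + b))) + (1 + (1 + (1 + u)) + 2)) + 1 +
          (1 + (1 + 2 + (1 + F + (1 + (1 + 1 + 6) + (1 + (1 + (1 + suc κ) + (1 + u)) + 1))) + 4)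
             + (1 + 11 + 1 +
                (1 + (1 + (1 + u) + 5) + (1 + (1 + 2 + (1 + u)) + (1 + (1 + 2 + (1 + b)) +
                  (1 + (1 + (1 + b) + (1 + 2 + (1 + M))) + (1 + 7 + 4)))))))
          ≡ F + (87 + 4 * u + 3 * b + M + κ)
      identity = solve-∀

  try-cost : ∀ u b → cost (2 + κ) (tryₚ u b) ≤ 38 * (2 + κ)
  try-cost u b = begin
    16 + (cost (2 + κ) fill + (11 + (2 + κ)) + 4 + 42)  ≤⟨ +-monoʳ-≤ 16 (+-monoˡ-≤ 42 (+-monoˡ-≤ 4
                                                        (+-monoˡ-≤ (11 + (2 + κ)) (cost-forEach κ λ _ → ≤-refl)))) ⟩
    -- The constants add up to 76, which fixes the factor 38; the coefficient 4 of κ is padded up to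
    -- it.
    16 + (1 + κ * 3 + (11 + (2 + κ)) + 4 + 42)    ≤⟨ m≤m+n _ (34 * κ) ⟩
    16 + (1 + κ * 3 + (11 + (2 + κ)) + 4 + 42) + 34 * κ  ≡⟨ total κ ⟩
    38 * (2 + κ)                                  ∎
    where
    open ≤-Reasoning
    fill : Program
    fill = forEach κ (λ j → 1 at lit (1 + j) ≔ lit (N + κ * b + j))
    total : ∀ x → 16 + (1 + x * 3 + (11 + (2 + x)) + 4 + 42) + 34 * x ≡ 38 * (2 + x)
    total = solve-∀

  step-cost : cost (2 + κ) stepₚ ≤ 36 + N * (1 + B * (38 * (2 + κ)))
  step-cost = begin
    3 + (cost (2 + κ) scanₚ + 32)  ≤⟨ +-monoʳ-≤ 3 (+-monoˡ-≤ 32 (cost-forEach N λ {u} _ →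
                                        cost-forEach B λ {b} _ → try-cost u b)) ⟩
    3 + (1 + N * (1 + B * (38 * (2 + κ))) + 32)  ≡⟨ total (N * (1 + B * (38 * (2 + κ)))) ⟩
    36 + N * (1 + B * (38 * (2 + κ)))  ∎
    where
    open ≤-Reasoning
    total : ∀ x → 3 + (1 + x + 32) ≡ 36 + x
    total = solve-∀

  output-cost : cost (2 + κ) outputₚ ≤ 11 * (n * n)
  output-cost = begin
    cost (2 + κ) outputₚ            ≤⟨ cost-forEach (suc κ * ℓ + 1) (λ {x} _ → entry (x / suc κ) (x % suc κ)) ⟩
    1 + (suc κ * ℓ + 1) * (10 * n)  ≤⟨ +-mono-≤ (*-mono-≤ 0<n 0<n) (*-monoˡ-≤ (10 * n) path-fits) ⟩
    n * n + n * (10 * n)            ≡⟨ total n ⟩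
    11 * (n * n)                    ∎
    where
    open ≤-Reasoning
    total : ∀ n → n * n + n * (10 * n) ≡ 11 * (n * n)
    total = solve-∀
    bound : 7 + 3 * κ ≤ 10 * n
    bound = begin
      7 * 1 + 3 * κ  ≤⟨ +-mono-≤ (*-monoʳ-≤ 7 0<n) (*-monoʳ-≤ 3 κ≤n) ⟩
      7 * n + 3 * n  ≡⟨ *-distribʳ-+ n 7 3 ⟨
      10 * n         ∎
    entry : ∀ d q → 2 + evalTime (cellₑ d q) ≤ 10 * n
    entry d zero    = ≤-trans (m≤m+n 4 (3 + 3 * κ)) bound
    entry d (suc j) = begin
      2 + (1 + (1 + 1 + evalTime (times κ (7 at lit (suc d)))) + 1)
        ≡⟨ cong (λ t → 2 + (1 + (1 + 1 + t) + 1)) (evalTime-times κ (7 at lit (suc d))) ⟩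
      2 + (1 + (1 + 1 + (1 + κ * 3)) + 1)
        ≡⟨ shift κ ⟩
      7 + 3 * κ
        ≤⟨ bound ⟩
      10 * n ∎
      where
      shift : ∀ κ → 2 + (1 + (1 + 1 + (1 + κ * 3)) + 1) ≡ 7 + 3 * κ
      shift = solve-∀

  output-size : size outputₚ ≤ 18 * (n * n)
  output-size = begin
    size outputₚ                          ≤⟨ size-forEach (suc κ * ℓ + 1) (λ {x} x< → entry x (≤-trans (<⇒≤ x<) path-fits)
                                               (x / suc κ) (x % suc κ) (m%n<n x (suc κ)) (m≡m%n+[m/n]*n x (suc κ))) ⟩
    1 + (suc κ * ℓ + 1) * (1 + 16 * n)    ≤⟨ +-mono-≤ (*-mono-≤ 0<n 0<n) (*-mono-≤ path-fits (+-monoˡ-≤ (16 * n) 0<n)) ⟩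
    n * n + n * (n + 16 * n)              ≡⟨ total n ⟩
    18 * (n * n)                          ∎
    where
    open ≤-Reasoning
    total : ∀ n → n * n + n * (n + 16 * n) ≡ 18 * (n * n)
    total = solve-∀
    entry : ∀ x → x ≤ n → ∀ d q → q < suc κ → x ≡ q + d * suc κ → 1 + (1 + x) + exprSize (cellₑ d q) ≤ 16 * n
    entry x x≤n d zero _ x≡ = begin
      1 + (1 + x) + (1 + (1 + d))  ≡⟨ shift x d ⟩
      4 * 1 + x + d                ≤⟨ +-mono-≤ (+-mono-≤ (*-monoʳ-≤ 4 0<n) x≤n)
                                        (≤-trans (m≤m*n d (suc κ)) (≤-trans (≤-reflexive (sym x≡)) x≤n)) ⟩
      4 * n + n + n                ≤⟨ m≤m+n _ (10 * n) ⟩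
      4 * n + n + n + 10 * n       ≡⟨ total′ n ⟩
      16 * n                       ∎
      where
      shift : ∀ x d → 1 + (1 + x) + (1 + (1 + d)) ≡ 4 * 1 + x + d
      shift = solve-∀
      total′ : ∀ n → 4 * n + n + n + 10 * n ≡ 16 * n
      total′ = solve-∀
    entry x x≤n d (suc j) (s≤s j<κ) x≡ = begin
      1 + (1 + x) + (1 + (1 + (1 + N) + exprSize (times κ (7 at lit (suc d)))) + (1 + j))
        ≡⟨ cong (λ t → 1 + (1 + x) + (1 + (1 + (1 + N) + t) + (1 + j))) (exprSize-times κ (7 at lit (suc d))) ⟩
      1 + (1 + x) + (1 + (1 + (1 + N) + (1 + κ * (1 + (1 + (1 + suc d))))) + (1 + j))
        ≡⟨ shift x N κ d j ⟩
      7 * 1 + x + N + 4 * κ + d * κ + j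
        ≤⟨ +-mono-≤ (+-mono-≤ (+-mono-≤ (+-mono-≤ (+-mono-≤ (*-monoʳ-≤ 7 0<n) x≤n) spine≤n) (*-monoʳ-≤ 4 κ≤n))
             dκ≤n) (≤-trans (<⇒≤ j<κ) κ≤n) ⟩
      7 * n + n + n + 4 * n + n + n
        ≤⟨ m≤m+n _ n ⟩
      7 * n + n + n + 4 * n + n + n + n
        ≡⟨ total′ n ⟩
      16 * n ∎
      where
      dκ≤n : d * κ ≤ n
      dκ≤n = begin
        d * κ            ≤⟨ *-monoʳ-≤ d (n≤1+n κ) ⟩
        d * suc κ        ≤⟨ m≤n+m _ (suc j) ⟩
        suc j + d * suc κ ≡⟨ x≡ ⟨
        x                ≤⟨ x≤n ⟩
        n                ∎
      shift : ∀ x N κ d j → 1 + (1 + x) + (1 + (1 + (1 + N) + (1 + κ * (1 + (1 + (1 + suc d))))) + (1 + j))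
                          ≡ 7 * 1 + x + N + 4 * κ + d * κ + j
      shift = solve-∀
      total′ : ∀ n → 7 * n + n + n + 4 * n + n + n + n ≡ 16 * n
      total′ = solve-∀

  module _ (blocks-fit : B * (2 + κ) ≤ 3 * n ^ κ) where

    private
      Z : ℕ
      Z = n ^ (2 + κ)

    instance
      n≢0 : NonZero n
      n≢0 = >-nonZero 0<n

    nn≤Z : n * n ≤ Z
    nn≤Z = *-monoʳ-≤ n (m≤m*n n (n ^ κ) {{m^n≢0 n κ}})

    n≤Z : n ≤ Z
    n≤Z = ≤-trans (m≤m*n n n) nn≤Z

    0<Z : 0 < Z
    0<Z = ≤-trans 0<n n≤Z

    scan-size : size scanₚ ≤ 201 * Z
    scan-size = begin
      size scanₚ
        ≤⟨ size-forEach N (λ u<N → size-forEach B (λ b<B → try-size u<N b<B)) ⟩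
      1 + N * suc (1 + B * suc (64 * ((2 + κ) * n)))
        ≡⟨ expand N B κ n ⟩
      1 + 2 * N + N * B + 64 * (N * (B * (2 + κ)) * n)
        ≤⟨ +-mono-≤ (+-mono-≤ (+-mono-≤ 0<Z (*-monoʳ-≤ 2 (≤-trans spine≤n n≤Z)))
             (≤-trans (*-mono-≤ spine≤n (≤-trans (m≤m*n B (2 + κ)) blocks-fit)) nB≤))
             (*-monoʳ-≤ 64 (*-monoˡ-≤ n (*-mono-≤ spine≤n blocks-fit))) ⟩
      Z + 2 * Z + 3 * Z + 64 * (n * (3 * n ^ κ) * n)
        ≡⟨ total n (n ^ κ) ⟩
      198 * Z
        ≤⟨ *-monoˡ-≤ Z (m≤m+n 198 3) ⟩
      201 * Z ∎
      where
      open ≤-Reasoning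
      nB≤ : n * (3 * n ^ κ) ≤ 3 * Z
      nB≤ = begin
        n * (3 * n ^ κ)    ≡⟨ swap n (n ^ κ) ⟩
        3 * (n * n ^ κ)    ≤⟨ *-monoʳ-≤ 3 (m≤n*m (n * n ^ κ) n) ⟩
        3 * Z              ∎
        where
        swap : ∀ n w → n * (3 * w) ≡ 3 * (n * w)
        swap = solve-∀
      expand : ∀ N B κ n → 1 + N * suc (1 + B * suc (64 * ((2 + κ) * n))) ≡
                           1 + 2 * N + N * B + 64 * (N * (B * (2 + κ)) * n)
      expand = solve-∀
      total : ∀ n w → n * (n * w) + 2 * (n * (n * w)) + 3 * (n * (n * w)) + 64 * (n * (3 * w) * n) ≡ 198 * (n * (n * w))
      total = solve-∀

    main-size : size mainₚ ≤ 300 * Z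
    main-size = begin
      1 + (1 + (1 + (1 + suc ℓ) + 2) + (4 + (1 + size scanₚ + 37))) + size outputₚ
        ≡⟨ expand ℓ (size scanₚ) (size outputₚ) ⟩
      49 * 1 + ℓ + size scanₚ + size outputₚ
        ≤⟨ +-mono-≤ (+-mono-≤ (+-mono-≤ (*-monoʳ-≤ 49 0<Z) (≤-trans ℓ≤n n≤Z)) scan-size)
             (≤-trans output-size (*-monoʳ-≤ 18 nn≤Z)) ⟩
      49 * Z + Z + 201 * Z + 18 * Z
        ≤⟨ m≤m+n _ (31 * Z) ⟩
      49 * Z + Z + 201 * Z + 18 * Z + 31 * Z
        ≡⟨ total Z ⟩
      300 * Z ∎
      where
      open ≤-Reasoning
      ℓ≤n : ℓ ≤ n
      ℓ≤n = ≤-trans (≤-trans (m≤n*m ℓ (suc κ)) (m≤m+n _ 1)) path-fits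
      expand : ∀ l a b → 1 + (1 + (1 + (1 + suc l) + 2) + (4 + (1 + a + 37))) + b ≡ 49 * 1 + l + a + b
      expand = solve-∀
      total : ∀ z → 49 * z + z + 201 * z + 18 * z + 31 * z ≡ 300 * z
      total = solve-∀

    -- At most 7rN iterations at 80NBk each give 560 · rN² · Bk. Here rN² ≤ n² and Bk ≤ 3nᵏ⁻² yield
    -- 1680, and writing the output adds 11.
    main-cost : ∀ {r} → 0 < r → r * (N * N) ≤ n * n →
                suc (suc r * suc (2 * N)) * (5 + cost (2 + κ) stepₚ) + cost (2 + κ) outputₚ ≤ 1691 * Z
    main-cost {r} 0<r rounds-fit = begin
      suc (suc r * suc (2 * N)) * (5 + cost (2 + κ) stepₚ) + cost (2 + κ) outputₚ
        ≤⟨ +-mono-≤ (*-mono-≤ iterations (≤-trans (+-monoʳ-≤ 5 step-cost) iteration)) output-cost ⟩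
      7 * (r * N) * (80 * (N * (B * (2 + κ)))) + 11 * (n * n)
        ≡⟨ cong (_+ 11 * (n * n)) (regroup r N (B * (2 + κ))) ⟩
      560 * (r * (N * N) * (B * (2 + κ))) + 11 * (n * n)
        ≤⟨ +-mono-≤ (*-monoʳ-≤ 560 (*-mono-≤ rounds-fit blocks-fit)) (*-monoʳ-≤ 11 nn≤Z) ⟩
      560 * (n * n * (3 * n ^ κ)) + 11 * Z
        ≡⟨ total n (n ^ κ) ⟩
      1691 * Z ∎
      where
      open ≤-Reasoning
      iterations : suc (suc r * suc (2 * N)) ≤ 7 * (r * N)
      iterations = begin
        suc (suc r * suc (2 * N))
          ≤⟨ +-mono-≤ 0<r*N (*-mono-≤ {suc r} {2 * r} (+-mono-≤ 0<r (m≤m+n r 0)) (+-monoˡ-≤ (2 * N) 0<N)) ⟩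
        r * N + 2 * r * (N + 2 * N)
          ≡⟨ expand r N ⟩
        7 * (r * N) ∎
        where
        0<r*N : 0 < r * N
        0<r*N = *-mono-≤ 0<r 0<N
        expand : ∀ r N → r * N + 2 * r * (N + 2 * N) ≡ 7 * (r * N)
        expand = solve-∀
      0<Bk : 0 < B * (2 + κ)
      0<Bk = *-mono-≤ 0<B z<s
      iteration : 5 + (36 + N * (1 + B * (38 * (2 + κ)))) ≤ 80 * (N * (B * (2 + κ)))
      iteration = begin
        5 + (36 + N * (1 + B * (38 * (2 + κ))))   ≡⟨ expand N B (2 + κ) ⟩
        41 * 1 + N * 1 + 38 * (N * (B * (2 + κ)))
          ≤⟨ +-monoˡ-≤ _ (+-mono-≤ (*-monoʳ-≤ 41 (*-mono-≤ 0<N 0<Bk)) (*-monoʳ-≤ N 0<Bk)) ⟩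
        41 * (N * (B * (2 + κ))) + N * (B * (2 + κ)) + 38 * (N * (B * (2 + κ)))  ≡⟨ collect (N * (B * (2 + κ))) ⟩
        80 * (N * (B * (2 + κ)))                  ∎
        where
        expand : ∀ N B k → 5 + (36 + N * (1 + B * (38 * k))) ≡ 41 * 1 + N * 1 + 38 * (N * (B * k))
        expand = solve-∀
        collect : ∀ p → 41 * p + p + 38 * p ≡ 80 * p
        collect = solve-∀
      regroup : ∀ r N p → 7 * (r * N) * (80 * (N * p)) ≡ 560 * (r * (N * N) * p)
      regroup = solve-∀
      total : ∀ n w → 560 * (n * n * (3 * w)) + 11 * (n * (n * w)) ≡ 1691 * (n * (n * w))
      total = solve-∀

-- Choice of the parameters

cube≤4^ : ∀ r → r * (r * r) ≤ 2 ^ r * 2 ^ r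
cube≤4^ 0             = z≤n
cube≤4^ 1             = s≤s z≤n
-- The induction starts at 2 because (r + 1)³ ≤ 4r³ fails for r = 1.
cube≤4^ (suc (suc r)) = from2 r
  where
  open ≤-Reasoning
  from2 : ∀ r → (2 + r) * ((2 + r) * (2 + r)) ≤ 2 ^ (2 + r) * 2 ^ (2 + r)
  from2 zero    = m≤m+n 8 8
  from2 (suc r) = begin
    (3 + r) * ((3 + r) * (3 + r))
      ≤⟨ m≤m+n _ (5 + 21 * r + 15 * (r * r) + 3 * (r * (r * r))) ⟩
    (3 + r) * ((3 + r) * (3 + r)) + (5 + 21 * r + 15 * (r * r) + 3 * (r * (r * r)))
      ≡⟨ expand r ⟩
    4 * ((2 + r) * ((2 + r) * (2 + r)))
      ≤⟨ *-monoʳ-≤ 4 (from2 r) ⟩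
    4 * (2 ^ (2 + r) * 2 ^ (2 + r))
      ≡⟨ collect (2 ^ (2 + r)) ⟩
    2 ^ (3 + r) * 2 ^ (3 + r) ∎
    where
    expand : ∀ r → (3 + r) * ((3 + r) * (3 + r)) + (5 + 21 * r + 15 * (r * r) + 3 * (r * (r * r))) ≡
                   4 * ((2 + r) * ((2 + r) * (2 + r)))
    expand = solve-∀
    collect : ∀ p → 4 * (p * p) ≡ 2 * p * (2 * p)
    collect = solve-∀

m≤2^m : ∀ m → m ≤ 2 ^ m
m≤2^m zero    = z≤n
m≤2^m (suc m) = +-mono-≤ (m^n>0 2 m) (≤-trans (m≤2^m m) (m≤m+n _ 0))

module Assembly (κ L r n : ℕ) (2≤r : 2 ≤ r) (large : 2 ^ (r + 1) * suc L + κ * suc L * r ≤ n) where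

  ℓ h N : ℕ
  ℓ = suc L
  h = 2 ^ r * ℓ
  N = 2 * (r * ℓ)

  open ≤-Reasoning

  large′ : 2 * h + κ * ℓ * r ≤ n
  large′ = begin
    2 * (2 ^ r * ℓ) + κ * ℓ * r        ≡⟨ cong (_+ κ * ℓ * r) (*-assoc 2 (2 ^ r) ℓ) ⟨
    2 ^ suc r * ℓ + κ * ℓ * r          ≡⟨ cong (λ m → 2 ^ m * ℓ + κ * ℓ * r) (+-comm r 1) ⟨
    2 ^ (r + 1) * ℓ + κ * ℓ * r        ≤⟨ large ⟩
    n                                  ∎

  0<r : 0 < r
  0<r = ≤-trans (s≤s z≤n) 2≤r

  rℓ≤h : r * ℓ ≤ h
  rℓ≤h = *-monoˡ-≤ ℓ (m≤2^m r)

  N≤2h : N ≤ 2 * h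
  N≤2h = *-monoʳ-≤ 2 rℓ≤h

  2h≤n : 2 * h ≤ n
  2h≤n = m+n≤o⇒m≤o (2 * h) large′

  h≤n : h ≤ n
  h≤n = ≤-trans (m≤m+n h _) 2h≤n

  rℓ≤n : r * ℓ ≤ n
  rℓ≤n = ≤-trans rℓ≤h h≤n

  ℓ≤rℓ : ℓ ≤ r * ℓ
  ℓ≤rℓ = m≤n*m ℓ r {{>-nonZero 0<r}}

  ℓ≤n : ℓ ≤ n
  ℓ≤n = ≤-trans ℓ≤rℓ rℓ≤n

  0<N : 0 < N
  0<N = *-mono-≤ {1} {2} (s≤s z≤n) (*-mono-≤ 0<r z<s)

  N-large : suc (r * (2 * L)) < N
  N-large = begin
    2 + r * (2 * L)      ≤⟨ +-monoˡ-≤ (r * (2 * L)) (≤-trans 2≤r (m≤m+n r r)) ⟩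
    r + r + r * (2 * L)  ≡⟨ expand r L ⟩
    N                    ∎
    where
    expand : ∀ r l → r + r + r * (2 * l) ≡ 2 * (r * suc l)
    expand = solve-∀

  -- O(rN) iterations over N candidates each make r³ℓ² up to a constant, and 4 · 4ʳℓ² is the square
  -- of 2ʳ⁺¹ℓ ≤ n. Here the exponential in the bound on n goes into the running time.
  rounds-fit : r * (N * N) ≤ n * n
  rounds-fit = begin
    r * (N * N)                        ≡⟨ regroup r ℓ ⟩
    4 * (r * (r * r) * (ℓ * ℓ))        ≤⟨ *-monoʳ-≤ 4 (*-monoˡ-≤ (ℓ * ℓ) (cube≤4^ r)) ⟩
    4 * (2 ^ r * 2 ^ r * (ℓ * ℓ))      ≡⟨ regroup′ (2 ^ r) ℓ ⟩
    2 * h * (2 * h)                    ≤⟨ *-mono-≤ 2h≤n 2h≤n ⟩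
    n * n                              ∎
    where
    regroup : ∀ r l → r * (2 * (r * l) * (2 * (r * l))) ≡ 4 * (r * (r * r) * (l * l))
    regroup = solve-∀
    regroup′ : ∀ p l → 4 * (p * p * (l * l)) ≡ 2 * (p * l) * (2 * (p * l))
    regroup′ = solve-∀

  κrℓ≤n : κ * (r * ℓ) ≤ n
  κrℓ≤n = begin
    κ * (r * ℓ)  ≡⟨ regroup κ r ℓ ⟩
    κ * ℓ * r    ≤⟨ m+n≤o⇒n≤o (2 * h) large′ ⟩
    n            ∎
    where
    regroup : ∀ k r l → k * (r * l) ≡ k * l * r
    regroup = solve-∀

  path-fits : suc κ * ℓ + 1 ≤ n
  path-fits = begin
    suc κ * ℓ + 1            ≡⟨ regroup κ ℓ ⟩
    ℓ + 1 + κ * ℓ            ≤⟨ +-mono-≤ (+-mono-≤ (≤-trans ℓ≤rℓ rℓ≤h) (≤-trans (≤-trans z<s ℓ≤rℓ) rℓ≤h))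
                                        (m≤m*n (κ * ℓ) r {{>-nonZero 0<r}}) ⟩
    h + h + κ * ℓ * r        ≡⟨ cong (λ x → h + x + κ * ℓ * r) (+-identityʳ h) ⟨
    2 * h + κ * ℓ * r        ≤⟨ large′ ⟩
    n                        ∎
    where
    regroup : ∀ k l → suc k * l + 1 ≡ l + 1 + k * l
    regroup = solve-∀

  module _ (M : ℕ) (M≤ℓ : M ≤ ℓ) (M-extreme : Extreme L M) (disjoint : κ ≡ 0 ⊎ M ≡ 0) where

    B : ℕ
    B = suc (r * (L ∸ M))

    B≤rℓ : B ≤ r * ℓ
    B≤rℓ = begin
      suc (r * (L ∸ M))  ≤⟨ +-mono-≤ 0<r (*-monoʳ-≤ r (m∸n≤m L M)) ⟩
      r + r * L          ≡⟨ *-suc r L ⟨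
      r * ℓ              ∎

    fits-in : N + κ * B ≤ n
    fits-in = begin
      N + κ * B                ≤⟨ +-mono-≤ N≤2h (*-monoʳ-≤ κ B≤rℓ) ⟩
      2 * h + κ * (r * ℓ)      ≡⟨ cong (2 * h +_) (regroup κ r ℓ) ⟩
      2 * h + κ * ℓ * r        ≤⟨ large′ ⟩
      n                        ∎
      where
      regroup : ∀ k r l → k * (r * l) ≡ k * l * r
      regroup = solve-∀

    ramsey : B * (2 + κ) ≤ 3 * n ^ κ → ℛ (loosePath (2 + κ) ℓ) r 1991 n
    ramsey blocks-fit = mainₚ , λ χ → conclude (main-run χ fits-in disjoint 0<r M-extreme N-large ≤-refl)
      where
      open Algorithm κ L N B M using (mainₚ; outputₚ)
      open Cost κ L N B M n fits-in path-fits (≤-trans B≤rℓ rℓ≤n) (≤-trans M≤ℓ ℓ≤n) 0<N z<s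
      instance
        n-nonZero : NonZero n
        n-nonZero = >-nonZero 0<n
      open Correctness κ L N B M {n} {r}
      conclude : ∀ {χ : Coloring (complete (2 + κ) n) r} →
        (∃[ t ] ∃[ s ] Run χ (λ _ _ → 0) mainₚ t s × OutputsMonochromaticCopy (loosePath (2 + κ) ℓ) χ s ×
          t ≤ loop-time χ fits-in disjoint + cost (2 + κ) outputₚ) →
        ∃[ t ] ∃[ s ] Run χ (λ _ _ → 0) mainₚ t s × OutputsMonochromaticCopy (loosePath (2 + κ) ℓ) χ s ×
          size mainₚ + t ≤ 1991 * n ^ (2 + κ)
      conclude (t , s , run , outputs , t≤) = t , s , run , outputs , (begin
        size mainₚ + t
          ≤⟨ +-mono-≤ (main-size blocks-fit) (≤-trans t≤ (main-cost blocks-fit 0<r rounds-fit)) ⟩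
        300 * n ^ (2 + κ) + 1691 * n ^ (2 + κ)
          ≡⟨ *-distribʳ-+ (n ^ (2 + κ)) 300 1691 ⟨
        1991 * n ^ (2 + κ) ∎)

-- For κ = 0 the choice `M = ℓ` makes `L ∸ M` vanish, so that one shared empty block suffices. For κ
-- > 0 the choice `M = 0` takes up to rℓ blocks, for which the summand κℓr in the bound on n has
-- room.
loosePath-ramsey : ∀ κ L r n → 2 ≤ r → 2 ^ (r + 1) * suc L + κ * suc L * r ≤ n →
                   ℛ (loosePath (2 + κ) (suc L)) r 1991 n
loosePath-ramsey zero L r n 2≤r large =
  ramsey (suc L) ≤-refl (inj₂ ≤-refl) (inj₁ refl) (≤-trans (≤-reflexive (cong (λ b → suc b * 2) r*0≡0)) (n≤1+n 2))
  where
  open Assembly 0 L r n 2≤r large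
  r*0≡0 : r * (L ∸ suc L) ≡ 0
  r*0≡0 = trans (cong (r *_) (m≤n⇒m∸n≡0 (n≤1+n L))) (*-zeroʳ r)
loosePath-ramsey (suc κ) L r n 2≤r large = ramsey 0 z≤n (inj₁ refl) (inj₂ refl) (begin
  -- Blocks have size κ + 1 here and edges size κ + 3, which is at most three times as large; this
  -- is the origin of the 3 in the bound on Bk.
  suc (r * L) * (3 + κ)            ≤⟨ *-mono-≤ (B≤rℓ 0 z≤n (inj₁ refl) (inj₂ refl)) (m≤m+n (3 + κ) (2 * κ)) ⟩
  r * suc L * (3 + κ + 2 * κ)      ≡⟨ regroup (r * suc L) κ ⟩
  3 * (suc κ * (r * suc L))        ≤⟨ *-monoʳ-≤ 3 κrℓ≤n ⟩
  3 * n                            ≤⟨ *-monoʳ-≤ 3 (m≤m*n n (n ^ κ) {{m^n≢0 n κ {{>-nonZero (≤-trans z<s ℓ≤n)}}}}) ⟩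
  3 * n ^ suc κ                    ∎)
  where
  open Assembly (suc κ) L r n 2≤r large
  open ≤-Reasoning
  regroup : ∀ p k → p * (3 + k + 2 * k) ≡ 3 * (suc k * p)
  regroup = solve-∀

theorem3 : Σ[ c ∈ ℕ ] c > 0 × (∀ (k ℓ r n : ℕ) → k ≥ 2 → ℓ ≥ 3 → r ≥ 2 →
    n ≥ 2 ^ (r + 1) * ℓ + (k ∸ 2) * ℓ * r → ℛ (loosePath k ℓ) r c n)
theorem3 = 1991 , z<s , λ { (suc (suc κ)) (suc L) r n (s≤s (s≤s _)) (s≤s _) → loosePath-ramsey κ L r n }
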